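{- Let $k,d,n$ be integers with $3\le k\le d+1$ and $n\ge 3$. \begin{enumerate} \item Suppose $\mathrm{diam}(C_n)<d$. (a) If $\mathrm{diam}(C_n)\le k-2$, then $C_n$ is $k,d$-perfect. (b) If $\mathrm{diam}(C_n)>k-2$, then $C_n$ is $k,d$-perfect if and only if \[n\le (2k-3)\left\lceil\frac{\lfloor n/2\rfloor+1}{k-1}\right\rceil .\] \item Suppose $d\le \mathrm{diam}(C_n)$ and define $q=\frac{d+1}{k-1}$. (a) If $q\in\mathbb Z$, then $C_n$ is $k,d$-perfect if and only if $q\mid n$. (b) If $q\notin\mathbb Z$, then $C_n$ is $k,d$-perfect if and only if there is no integer $j$ with \[1\le j<\frac{q-1}{\lceil q\rceil-q}\quad\text{and}\quad j\lceil q\rceil<n<(j+1)q .\] \end{enumerate}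
   Context: $C_n$ is the cycle graph on $n$ vertices; $\mathrm{diam}(C_n)=\lfloor n/2\rfloor$. All graphs are simple and undirected with nonempty vertex set. A shortest path in a graph $G$ is a path between some vertices $u,v$ whose length (number of edges) equals the graph distance between $u$ and $v$. A set $S\subseteq V(G)$ is $k,d$-independent in $G$ if every shortest path in $G$ of length at most $d$ contains fewer than $k$ vertices of $S$. The $k,d$-chromatic number $\chi^k_d(G)$ is the least positive integer $c$ such that some coloring $V(G)\to\{1,\dots,c\}$ has all color classes $k,d$-independent. A set $S\subseteq V(G)$ is a $k,d$-clique in $G$ if every $k$-element subset of $S$ is contained in some shortest path of $G$ of length at most $d$ (sets with fewer than $k$ elements are vacuously $k,d$-cliques); $\omega^k_d(G)$ is the supremum of the sizes of $k,d$-cliques in $G$. For $2\le k\le d+1$, $G$ is $k,d$-perfect if $\chi^k_d(H)=\left\lceil\frac{\omega^k_d(H)}{k-1}\right\rceil$ for every induced subgraph $H$ of $G$ (shortest paths being computed in $H$). -}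

module Defs where

open import Data.Fin.Base using (Fin; toℕ)
open import Data.Fin.Properties using () renaming (_≟_ to _≟ᶠ_)
open import Data.Fin.Subset using (Subset; _⊆_; _∩_; ⋃; ⁅_⁆; ∣_∣)
open import Data.Integer.Base using (ℤ; +_)
open import Data.List.Base using (List; []; _∷_; map)
open import Data.List.Relation.Unary.Unique.Propositional using (Unique)
open import Data.Nat.Base as ℕ using (ℕ; suc; _≤_; _<_; _∸_; NonZero; z≤n; s≤s)
open import Data.Nat.Properties using (_≟_; ≤-trans; 1+n≢n; <-irrefl)
open import Data.Product.Base using (Σ-syntax; ∃-syntax; _×_; _,_)
open import Data.Rational.Base as ℚ using (ℚ; _/_; ceiling)
open import Data.Rational.Properties using (+-0-group)
open import Data.Sum.Base using (_⊎_; inj₁; inj₂; swap)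
open import Data.Vec.Base using (tabulate)
open import Function.Bundles using (_↣_; Injection)
open import Level using (0ℓ)
open import Relation.Binary.Core using (Rel)
open import Relation.Binary.Construct.Closure.ReflexiveTransitive using (Star; ε; _◅_)
open import Relation.Binary.Definitions using (Symmetric; Irreflexive; Decidable)
open import Relation.Binary.PropositionalEquality using (_≡_; _≢_; refl; sym; trans; cong)
open import Relation.Nullary using (¬_; does)
open import Relation.Nullary.Decidable using (_⊎-dec_; _×-dec_)
import Algebra.Properties.Group as GroupProperties

record Graph (n : ℕ) : Set₁ where
  field
    .nonEmpty : NonZero n
    Adj       : Rel (Fin n) 0ℓ
    adj?      : Decidable Adj
    symm      : Symmetric Adj
    irrefl    : Irreflexive _≡_ Adj

-- Every induced subgraph of G is, up to relabelling its vertices, the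
-- pullback of G along an injection enumerating its vertex set.
induced : ∀ {m n} → .{{NonZero m}} → Graph n → Fin m ↣ Fin n → Graph m
induced {{nz}} G f = record
  { nonEmpty = nz
  ; Adj      = λ u v → Adj (to u) (to v)
  ; adj?     = λ u v → adj? (to u) (to v)
  ; symm     = symm
  ; irrefl   = λ u≡v → irrefl (cong to u≡v)
  }
  where
  open Graph G
  open Injection f using (to)

module _ {n : ℕ} {Adj : Rel (Fin n) 0ℓ} where

  length : ∀ {u v} → Star Adj u v → ℕ
  length ε       = 0
  length (_ ◅ w) = suc (length w)

  vertices : ∀ {u v} → Star Adj u v → List (Fin n)
  vertices {u} ε       = u ∷ []
  vertices {u} (_ ◅ w) = u ∷ vertices w

  vertexSet : ∀ {u v} → Star Adj u v → Subset n
  vertexSet w = ⋃ (map ⁅_⁆ (vertices w))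

  IsPath : ∀ {u v} → Star Adj u v → Set
  IsPath w = Unique (vertices w)

module _ {n : ℕ} (G : Graph n) where
  open Graph G using (Adj)

  Walk : Rel (Fin n) 0ℓ
  Walk = Star Adj

  IsDistance : Fin n → Fin n → ℕ → Set
  IsDistance u v ℓ =
      (Σ[ w ∈ Walk u v ] (IsPath w × length w ≡ ℓ))
    × (∀ (w : Walk u v) → IsPath w → ℓ ≤ length w)

  -- Requires all distances to be finite, i.e. G connected.
  IsDiameter : ℕ → Set
  IsDiameter D =
      (∃[ u ] ∃[ v ] IsDistance u v D)
    × (∀ u v → ∃[ ℓ ] (IsDistance u v ℓ × ℓ ≤ D))

  IsShortestPath : ∀ {u v} → Walk u v → Set
  IsShortestPath {u} {v} w = IsPath w × IsDistance u v (length w)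

  Independent : (k d : ℕ) → Subset n → Set
  Independent k d S =
    ∀ {u v} (w : Walk u v) → IsShortestPath w → length w ≤ d →
    ∣ S ∩ vertexSet w ∣ < k

  Clique : (k d : ℕ) → Subset n → Set
  Clique k d S =
    ∀ (T : Subset n) → T ⊆ S → ∣ T ∣ ≡ k →
    ∃[ u ] ∃[ v ] Σ[ w ∈ Walk u v ]
      (IsShortestPath w × length w ≤ d × T ⊆ vertexSet w)

  colourClass : ∀ {c} → (Fin n → Fin c) → Fin c → Subset n
  colourClass f i = tabulate (λ v → does (f v ≟ᶠ i))

  Colourable : (k d c : ℕ) → Set
  Colourable k d c =
    Σ[ f ∈ (Fin n → Fin c) ] (∀ i → Independent k d (colourClass f i))

  IsChromaticNumber : (k d c : ℕ) → Set
  IsChromaticNumber k d c =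
      1 ≤ c
    × Colourable k d c
    × (∀ c′ → 1 ≤ c′ → Colourable k d c′ → c ≤ c′)

  -- The supremum is attained because the vertex set is finite.
  IsCliqueNumber : (k d ω : ℕ) → Set
  IsCliqueNumber k d ω =
      (∃[ S ] (Clique k d S × ∣ S ∣ ≡ ω))
    × (∀ S → Clique k d S → ∣ S ∣ ≤ ω)

-- Meaningful for 2 ≤ k ≤ d + 1.
Perfect : ∀ {n} → Graph n → (k d : ℕ) → .{{NonZero (k ∸ 1)}} → Set
Perfect {n} G k d =
  ∀ m → .{{_ : NonZero m}} → (f : Fin m ↣ Fin n) →
  ∃[ χ ] ∃[ ω ]
    ( IsChromaticNumber (induced G f) k d χ
    × IsCliqueNumber (induced G f) k d ω
    × + χ ≡ ⌈ (+ ω) / (k ∸ 1) ⌉)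

-- v follows u in the cyclic order 0, 1, …, n-1, 0.
Next : ∀ {n} → Rel (Fin n) 0ℓ
Next {n} u v = suc (toℕ u) ≡ toℕ v ⊎ (suc (toℕ u) ≡ n × toℕ v ≡ 0)

cycle : (n : ℕ) → 3 ≤ n → Graph n
cycle n 3≤n = record
  { nonEmpty = ℕ.>-nonZero (≤-trans (s≤s z≤n) 3≤n)
  ; Adj      = λ u v → Next u v ⊎ Next v u
  ; adj?     = λ u v → next? u v ⊎-dec next? v u
  ; symm     = swap
  ; irrefl   = λ { refl (inj₁ p) → next-irrefl p ; refl (inj₂ p) → next-irrefl p }
  }
  where
  next? : Decidable (Next {n})
  next? u v = (suc (toℕ u) ≟ toℕ v) ⊎-dec ((suc (toℕ u) ≟ n) ×-dec (toℕ v ≟ 0))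

  next-irrefl : ∀ {u : Fin n} → ¬ Next u u
  next-irrefl (inj₁ 1+u≡u)         = 1+n≢n 1+u≡u
  next-irrefl (inj₂ (1+u≡n , u≡0)) =
    <-irrefl (trans (sym (cong suc u≡0)) 1+u≡n) (≤-trans (s≤s (s≤s z≤n)) 3≤n)

NonInteger : ℚ → Set
NonInteger q = ∀ (z : ℤ) → q ≢ z / 1

k∸1-nonZero : ∀ {k} → 3 ≤ k → NonZero (k ∸ 1)
k∸1-nonZero (s≤s (s≤s _)) = _

⌈q⌉-q-nonZero : ∀ {q} → NonInteger q → ℚ.NonZero (⌈ q ⌉ / 1 ℚ.- q)
⌈q⌉-q-nonZero {q} q∉ℤ = ℚ.≢-nonZero λ eq →
  q∉ℤ ⌈ q ⌉ (sym (x∙y⁻¹≈ε⇒x≈y (⌈ q ⌉ / 1) q eq))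
  where open GroupProperties +-0-group using (x∙y⁻¹≈ε⇒x≈y)

{-# OPTIONS --safe #-}

-- Put s = k - 1, m = min (d, diam) + 1 and c = ⌈m / s⌉. The shortest paths of length at most d in Cₙ
-- are arcs, and the longest of them have m vertices; such an arc is a clique with more than (c - 1) s
-- vertices. For any graph, a clique of size greater than (c - 1) s together with a colouring with c
-- colours forces χ = c = ⌈ω / s⌉.
--
-- A proper induced subgraph lives on a cycle cut open at a missing vertex, where the periodic colouring
-- is optimal, so only Cₙ itself matters. A colour class X of Cₙ meets each of the n windows of m
-- consecutive vertices at most s times, whence m |X| ≤ n s. Conversely, if t m ≤ n s and n ≤ c t, cut
-- Cₙ into t blocks of nearly equal size and colour each vertex by its position in its block. So c
-- colours suffice if and only if t m ≤ n s and n ≤ c t for some t, and every case of the theorem is an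
-- arithmetical reformulation of this.
--
-- That cliques of Cₙ have at most c s vertices uses k ≥ 3: any three vertices of a clique lie on an arc
-- of m vertices, so "at most m - 1 steps ahead" is a transitive tournament on the clique, whose source
-- begins an arc containing it; antipodal pairs, which are ahead of each other, allow at most 4 ≤ c s
-- vertices.
module Submission where

open import Defs
open import Data.Bool.Base using (true; false)
open import Data.Fin.Base using (Fin; zero; suc; toℕ; fromℕ<)
open import Data.Fin.Properties using (any?; all?; ¬∀⟶∃¬; toℕ<n; toℕ-fromℕ<; toℕ-injective)
  renaming (_≟_ to _≟ᶠ_)
open import Data.Fin.Subset using (Subset; _⊆_; _∩_; _∪_; ⋃; ⁅_⁆; ∣_∣; _∈_; _-_; ⊤; ⊥)
open import Data.Fin.Subset.Properties
open import Data.Integer.Base as ℤ using (ℤ)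
import Data.Integer.DivMod as ℤ
import Data.Integer.GCD as ℤ using (gcd)
import Data.Integer.Properties as ℤ
import Data.Integer.Tactic.RingSolver as ℤ-Solver
open import Data.List.Base using (List; []; _∷_; _++_; map; allFin; applyUpTo; filter)
import Data.List.Base as List
open import Data.List.Membership.Propositional using () renaming (_∈_ to _∈ˡ_)
open import Data.List.Membership.Propositional.Properties
  using (∈-applyUpTo⁺; ∈-applyUpTo⁻; ∈-filter⁺; ∈-filter⁻; ∈-allFin)
open import Data.List.Properties using (length-applyUpTo; length-++; filter-++)
import Data.List.Relation.Unary.All as All
open import Data.List.Relation.Unary.AllPairs using (allPairs?; []; _∷_)
open import Data.List.Relation.Unary.Any using (here; there)
open import Data.List.Relation.Unary.Unique.Propositional using (Unique)
import Data.List.Relation.Unary.Unique.Propositional.Properties as Unique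
open import Data.Nat.Base
  using (ℕ; zero; suc; _+_; _*_; _∸_; _≤_; _<_; _>_; z≤n; s≤s; NonZero; >-nonZero; >-nonZero⁻¹; ⌊_/2⌋)
open import Data.Nat.Divisibility using (divides) renaming (_∣_ to _∣ⁿ_)
open import Data.Nat.DivMod
  using (_%_; m≡m%n+[m/n]*n; [m+n]%n≡m%n; [m+kn]%n≡m%n; m<n⇒m%n≡m; m%n%n≡m%n; n%n≡0; m%n<n; %-distribˡ-*; %-distribˡ-+;
         /-monoˡ-≤; m*n/n≡m; m/n*n≤m; m<n*o⇒m/o<n; m≥n⇒m/n>0)
  renaming (_/_ to _/ℕ_)
open import Data.Nat.Properties
open import Data.Nat.Tactic.RingSolver using (solve-∀)
open import Data.Product.Base using (Σ-syntax; ∃-syntax; _×_; _,_; proj₁; proj₂)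
open import Data.Rational.Base as ℚ using (ℚ; 1ℚ; _/_; ceiling; toℚᵘ; mkℚ; ↥_; ↧_)
import Data.Rational.Properties as ℚ
open import Data.Rational.Solver using (module +-*-Solver)
open import Data.Rational.Unnormalised.Base as ℚᵘ using (mkℚᵘ; *≡*; *<*)
import Data.Rational.Unnormalised.Properties as ℚᵘ
open import Data.Sum.Base using (_⊎_; inj₁; inj₂; [_,_]′)
open import Data.Vec.Base using ([]; _∷_; here; there)
open import Data.Vec.Properties using (lookup∘tabulate; lookup⇒[]=; []=⇒lookup)
open import Function.Base using (_∘_)
open import Function.Bundles using (_↣_; Injection; _⇔_; mk⇔)
open import Function.Construct.Composition using () renaming (equivalence to ⇔-trans)
open import Function.Construct.Identity using (↣-id)
open import Relation.Binary.Construct.Closure.ReflexiveTransitive using (ε; _◅_)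
open import Relation.Binary.Definitions using (tri<; tri≈; tri>)
open import Relation.Binary.PropositionalEquality
  using (_≡_; _≢_; refl; sym; trans; cong; cong₂; subst; subst₂; module ≡-Reasoning)
open import Relation.Nullary using (¬_; Dec; yes; no; does; ¬?; contradiction)
open import Relation.Nullary.Decidable using (_×-dec_; map′; decidable-stable; dec-true)

-- Cardinalities of finite subsets

∣p∪q∣≤∣p∣+∣q∣ : ∀ {n} (p q : Subset n) → ∣ p ∪ q ∣ ≤ ∣ p ∣ + ∣ q ∣
∣p∪q∣≤∣p∣+∣q∣ []            []            = z≤n
∣p∪q∣≤∣p∣+∣q∣ (true ∷ p)  (true ∷ q)  =
  s≤s (≤-trans (∣p∪q∣≤∣p∣+∣q∣ p q) (+-monoʳ-≤ ∣ p ∣ (n≤1+n ∣ q ∣)))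
∣p∪q∣≤∣p∣+∣q∣ (true ∷ p)  (false ∷ q) = s≤s (∣p∪q∣≤∣p∣+∣q∣ p q)
∣p∪q∣≤∣p∣+∣q∣ (false ∷ p) (true ∷ q)  =
  ≤-trans (s≤s (∣p∪q∣≤∣p∣+∣q∣ p q)) (≤-reflexive (sym (+-suc ∣ p ∣ ∣ q ∣)))
∣p∪q∣≤∣p∣+∣q∣ (false ∷ p) (false ∷ q) = ∣p∪q∣≤∣p∣+∣q∣ p q

fromList : ∀ {n} → List (Fin n) → Subset n
fromList l = ⋃ (map ⁅_⁆ l)

∈fromList⁺ : ∀ {n} {x : Fin n} {l} → x ∈ˡ l → x ∈ fromList l
∈fromList⁺ (here refl) = x∈p∪q⁺ (inj₁ (x∈⁅x⁆ _))
∈fromList⁺ (there x∈l) = x∈p∪q⁺ (inj₂ (∈fromList⁺ x∈l))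

∈fromList⁻ : ∀ {n} {x : Fin n} l → x ∈ fromList l → x ∈ˡ l
∈fromList⁻ []      x∈ = contradiction x∈ ∉⊥
∈fromList⁻ (y ∷ l) x∈ with x∈p∪q⁻ ⁅ y ⁆ (fromList l) x∈
... | inj₁ x∈y = here (x∈⁅y⁆⇒x≡y y x∈y)
... | inj₂ x∈l = there (∈fromList⁻ l x∈l)

∣fromList∣≤length : ∀ {n} (l : List (Fin n)) → ∣ fromList l ∣ ≤ List.length l
∣fromList∣≤length {n} []  = ≤-reflexive (∣⊥∣≡0 n)
∣fromList∣≤length (x ∷ l) = ≤-trans (∣p∪q∣≤∣p∣+∣q∣ ⁅ x ⁆ (fromList l))
  (+-mono-≤ (≤-reflexive (∣⁅x⁆∣≡1 x)) (∣fromList∣≤length l))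

∣p∣≤length : ∀ {n} {p : Subset n} (l : List (Fin n)) → (∀ {x} → x ∈ p → x ∈ˡ l) → ∣ p ∣ ≤ List.length l
∣p∣≤length l p⊆l = ≤-trans (p⊆q⇒∣p∣≤∣q∣ (∈fromList⁺ ∘ p⊆l)) (∣fromList∣≤length l)

length≤∣p∣ : ∀ {n} {p : Subset n} {l : List (Fin n)} → Unique l → (∀ {x} → x ∈ˡ l → x ∈ p) → List.length l ≤ ∣ p ∣
length≤∣p∣ []        l⊆p = z≤n
length≤∣p∣ (x∉l ∷ u) l⊆p = ≤-trans
  (s≤s (length≤∣p∣ u λ y∈l → x∈p∧x≢y⇒x∈p-y (l⊆p (there y∈l)) (All.lookup x∉l y∈l ∘ sym)))
  (x∈p⇒∣p-x∣<∣p∣ (l⊆p (here refl)))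

∣p∣≤1+∣p-x∣ : ∀ {n} (p : Subset n) x → ∣ p ∣ ≤ suc ∣ p - x ∣
∣p∣≤1+∣p-x∣ p x = ≤-trans (p⊆q⇒∣p∣≤∣q∣ p⊆)
  (≤-trans (∣p∪q∣≤∣p∣+∣q∣ ⁅ x ⁆ (p - x)) (+-monoˡ-≤ ∣ p - x ∣ (≤-reflexive (∣⁅x⁆∣≡1 x))))
  where
  p⊆ : p ⊆ ⁅ x ⁆ ∪ (p - x)
  p⊆ {y} y∈p with y ≟ᶠ x
  ... | yes refl = x∈p∪q⁺ (inj₁ (x∈⁅x⁆ x))
  ... | no y≢x   = x∈p∪q⁺ (inj₂ (x∈p∧x≢y⇒x∈p-y y∈p y≢x))

x∈p-y⇒x≢y : ∀ {n} {x y : Fin n} (p : Subset n) → x ∈ p - y → x ≢ y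
x∈p-y⇒x≢y {y = zero}  (_ ∷ p) ()         refl
x∈p-y⇒x≢y {y = suc y} (_ ∷ p) (there x∈) refl = x∈p-y⇒x≢y p x∈ refl

⋃-bound : ∀ {n} c b (F : Fin c → Subset n) → (∀ i → ∣ F i ∣ ≤ b) → ∣ ⋃ (List.tabulate F) ∣ ≤ c * b
⋃-bound {n} zero b F _ = ≤-reflexive (∣⊥∣≡0 n)
⋃-bound (suc c) b F F≤b = ≤-trans (∣p∪q∣≤∣p∣+∣q∣ (F zero) _)
  (+-mono-≤ (F≤b zero) (⋃-bound c b (F ∘ suc) (F≤b ∘ suc)))

∈⋃ : ∀ {n} c (F : Fin c → Subset n) {x} i → x ∈ F i → x ∈ ⋃ (List.tabulate F)
∈⋃ (suc c) F zero    x∈ = x∈p∪q⁺ (inj₁ x∈)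
∈⋃ (suc c) F (suc i) x∈ = x∈p∪q⁺ {p = F zero} (inj₂ (∈⋃ c (F ∘ suc) i x∈))

covered⇒∣p∣≤ : ∀ {n} c b {p : Subset n} (F : Fin c → Subset n) →
  (∀ {x} → x ∈ p → ∃[ i ] x ∈ F i) → (∀ i → ∣ F i ∣ ≤ b) → ∣ p ∣ ≤ c * b
covered⇒∣p∣≤ c b F cover F≤b = ≤-trans
  (p⊆q⇒∣p∣≤∣q∣ λ x∈p → ∈⋃ c F (proj₁ (cover x∈p)) (proj₂ (cover x∈p))) (⋃-bound c b F F≤b)

-- Cliques are tested on sets of exactly `k` elements. This enlarges a small set, or cuts down a
-- large one, to that size.
interpolate : ∀ {n} k (p q : Subset n) → p ⊆ q → ∣ p ∣ ≤ k → k ≤ ∣ q ∣ →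
  ∃[ r ] (p ⊆ r × r ⊆ q × ∣ r ∣ ≡ k)
interpolate k [] [] _ _ k≤0 = [] , (λ ()) , (λ ()) , sym (n≤0⇒n≡0 k≤0)
interpolate k (true ∷ p) (false ∷ q) p⊆q _ _ with () ← p⊆q here
interpolate (suc k) (true ∷ p) (true ∷ q) p⊆q (s≤s p≤k) (s≤s k≤q)
  with r , p⊆r , r⊆q , r≡k ← interpolate k p q (drop-∷-⊆ p⊆q) p≤k k≤q
  = true ∷ r , in⊆in p⊆r , in⊆in r⊆q , cong suc r≡k
interpolate k (false ∷ p) (false ∷ q) p⊆q p≤k k≤q
  with r , p⊆r , r⊆q , r≡k ← interpolate k p q (drop-∷-⊆ p⊆q) p≤k k≤q
  = false ∷ r , out⊆ p⊆r , out⊆ r⊆q , r≡k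
interpolate k (false ∷ p) (true ∷ q) p⊆q p≤k k≤1+q with k ≤? ∣ q ∣
... | yes k≤q with r , p⊆r , r⊆q , r≡k ← interpolate k p q (drop-∷-⊆ p⊆q) p≤k k≤q
  = false ∷ r , out⊆ p⊆r , out⊆ r⊆q , r≡k
-- The tail of `q` is too small by itself, so `r` has to be all of `q`.
... | no  k≰q = true ∷ q , out⊆ (drop-∷-⊆ p⊆q) , ⊆-refl , ≤-antisym (≰⇒> k≰q) k≤1+q

minimum : ∀ {n} (p : Subset n) (g : Fin n → ℕ) x → x ∈ p → ∃[ y ] (y ∈ p × (∀ z → z ∈ p → g y ≤ g z))
minimum p g x = go (g x) x ≤-refl
  where
  go : ∀ b x → g x ≤ b → x ∈ p → ∃[ y ] (y ∈ p × (∀ z → z ∈ p → g y ≤ g z))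
  go b x gx≤b x∈p with any? (λ z → (z ∈? p) ×-dec (g z <? g x))
  ... | no ∄z = x , x∈p , λ z z∈p → ≮⇒≥ λ gz<gx → ∄z (z , z∈p , gz<gx)
  go zero    x gx≤b x∈p | yes (z , z∈p , gz<gx) = contradiction (≤-trans gz<gx gx≤b) λ ()
  go (suc b) x gx≤b x∈p | yes (z , z∈p , gz<gx) = go b z (≤-pred (≤-trans gz<gx gx≤b)) z∈p

-- Pigeonhole by induction on the length of the interval: at most one element takes the smallest
-- value `a`; remove it and shrink the interval from below.
injective⇒∣p∣≤ : ∀ {n} s a (p : Subset n) (g : Fin n → ℕ) →
  (∀ {x y} → x ∈ p → y ∈ p → g x ≡ g y → x ≡ y) →
  (∀ {x} → x ∈ p → a ≤ g x) → (∀ {x} → x ∈ p → g x < a + s) → ∣ p ∣ ≤ s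
injective⇒∣p∣≤ zero a p g inj a≤ <a = ∣p∣≤length [] λ x∈p →
  contradiction (≤-trans (<a x∈p) (≤-trans (≤-reflexive (+-identityʳ a)) (a≤ x∈p))) (<-irrefl refl)
injective⇒∣p∣≤ (suc s) a p g inj a≤ <a with any? (λ x → (x ∈? p) ×-dec (g x ≟ a))
... | no ∄x = m≤n⇒m≤1+n (injective⇒∣p∣≤ s (suc a) p g inj
  (λ {x} x∈p → ≤∧≢⇒< (a≤ x∈p) λ a≡gx → ∄x (x , x∈p , sym a≡gx))
  (λ x∈p → ≤-trans (<a x∈p) (≤-reflexive (+-suc a s))))
... | yes (x , x∈p , gx≡a) = ≤-trans (∣p∣≤1+∣p-x∣ p x) (s≤s (injective⇒∣p∣≤ s (suc a) (p - x) g
  (λ y∈ z∈ → inj (p─q⊆p p ⁅ x ⁆ y∈) (p─q⊆p p ⁅ x ⁆ z∈))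
  (λ y∈ → ≤∧≢⇒< (a≤ (p─q⊆p p ⁅ x ⁆ y∈)) λ a≡gy →
    x∈p-y⇒x≢y p y∈ (inj (p─q⊆p p ⁅ x ⁆ y∈) x∈p (trans (sym a≡gy) (sym gx≡a))))
  (λ y∈ → ≤-trans (<a (p─q⊆p p ⁅ x ⁆ y∈)) (≤-reflexive (+-suc a s)))))

-- The labels form a relation because a vertex gets its label through a lift chosen in some window.
-- Any choice of labels is injective and stays within `s` of its minimum.
spread⇒∣p∣≤ : ∀ {n} s (p : Subset n) (R : Fin n → ℕ → Set) → (∀ {x} → x ∈ p → ∃[ i ] R x i) →
  (∀ {x y i} → R x i → R y i → x ≡ y) → (∀ {x y i j} → R x i → R y j → j < i + s) → ∣ p ∣ ≤ s
spread⇒∣p∣≤ {n} s p R total inj spread with any? (_∈? p)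
... | no  ∄x = ≤-trans (∣p∣≤length [] λ x∈p → contradiction (_ , x∈p) ∄x) z≤n
... | yes (x₀ , x₀∈p) = injective⇒∣p∣≤ s (g x₁) p g
  (λ x∈ y∈ gx≡gy → inj (R-g x∈) (subst (R _) (sym gx≡gy) (R-g y∈)))
  (λ {y} → x₁-min y) (λ y∈ → spread (R-g x₁∈p) (R-g y∈))
  where
  g : Fin n → ℕ
  g x with x ∈? p
  ... | yes x∈p = proj₁ (total x∈p)
  -- An arbitrary value outside `p`; only members of `p` are compared.
  ... | no  _   = 0
  R-g : ∀ {x} → x ∈ p → R x (g x)
  R-g {x} x∈p with x ∈? p
  ... | yes x∈p′ = proj₂ (total x∈p′)
  ... | no  x∉p  = contradiction x∈p x∉p
  min = minimum p g x₀ x₀∈p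
  x₁ = proj₁ min
  x₁∈p = proj₁ (proj₂ min)
  x₁-min = proj₂ (proj₂ min)

greatest : (P : ℕ → Set) → (∀ i → Dec (P i)) → ∀ b i → i ≤ b → P i →
  ∃[ j ] (P j × j ≤ b × (∀ i → i ≤ b → P i → i ≤ j))
greatest P P? b i i≤b Pi with P? b
... | yes Pb = b , Pb , ≤-refl , λ _ i≤b _ → i≤b
greatest P P? zero    i z≤n Pi | no ¬P0 = contradiction Pi ¬P0
greatest P P? (suc b) i i≤b Pi | no ¬Pb =
  let j , Pj , j≤b , max = greatest P P? b i (below i i≤b Pi) Pi
  in j , Pj , m≤n⇒m≤1+n j≤b , λ i′ i′≤b Pi′ → max i′ (below i′ i′≤b Pi′) Pi′
  where
  below : ∀ i → i ≤ suc b → P i → i ≤ b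
  below i i≤b Pi = ≤-pred (≤∧≢⇒< i≤b λ { refl → ¬Pb Pi })

-- Ceilings of fractions

-- A ceiling unfolds to minus the floor of the negated fraction, hence the form of `z`. The product
-- of `z` and `suc d` exceeds `n` by the remainder of `- n`, which is less than `suc d`.
neg-/ℕ-bounds : ∀ n d → let z = ℤ.- ((ℤ.- n) ℤ./ (ℤ.+ suc d)) in
  n ℤ.≤ z ℤ.* (ℤ.+ suc d) × z ℤ.* (ℤ.+ suc d) ℤ.< n ℤ.+ (ℤ.+ suc d)
neg-/ℕ-bounds n d =
  subst (n ℤ.≤_) (sym zD≡n+r) (ℤ.i≤i+j n (ℤ.+ r)) ,
  subst (ℤ._< n ℤ.+ (ℤ.+ suc d)) (sym zD≡n+r) (ℤ.+-monoʳ-< n (ℤ.+<+ (ℤ.n%d<d (ℤ.- n) (ℤ.+ suc d))))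
  where
  r = (ℤ.- n) ℤ.% (ℤ.+ suc d)
  w = (ℤ.- n) ℤ./ (ℤ.+ suc d)
  rearrange : ∀ r w D → (ℤ.- w) ℤ.* D ≡ ℤ.- (r ℤ.+ w ℤ.* D) ℤ.+ r
  rearrange = ℤ-Solver.solve-∀
  zD≡n+r : (ℤ.- w) ℤ.* (ℤ.+ suc d) ≡ n ℤ.+ (ℤ.+ r)
  zD≡n+r = trans (rearrange (ℤ.+ r) w (ℤ.+ suc d)) (cong (ℤ._+ (ℤ.+ r))
    (trans (cong ℤ.-_ (sym (ℤ.a≡a%n+[a/n]*n (ℤ.- n) (ℤ.+ suc d)))) (ℤ.neg-involutive n)))

-- The split on the sign of the numerator lets the negation inside the ceiling compute.
⌈⌉-bounds : ∀ q → ↥ q ℤ.≤ ⌈ q ⌉ ℤ.* ↧ q × ⌈ q ⌉ ℤ.* ↧ q ℤ.< ↥ q ℤ.+ ↧ q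
⌈⌉-bounds (mkℚ (ℤ.+ zero)     d _) = neg-/ℕ-bounds (ℤ.+ zero) d
⌈⌉-bounds (mkℚ (ℤ.+ suc n)    d _) = neg-/ℕ-bounds (ℤ.+ suc n) d
⌈⌉-bounds (mkℚ (ℤ.-[1+ n ]) d _) = neg-/ℕ-bounds ℤ.-[1+ n ] d

-- The bounds on the ceiling concern the reduced fraction; multiplying by the gcd `g` restores `a`
-- and `s`. An interval of length `s`, closed below and open above, contains just one multiple of
-- `s`.
⌈/⌉-unique : ∀ a s c .{{_ : NonZero s}} → a ≤ c * s → c * s < a + s → ⌈ (ℤ.+ a) / s ⌉ ≡ ℤ.+ c
⌈/⌉-unique a s@(suc _) c a≤cs cs<a+s = ℤ.≤-antisym
  (below (ℤ.<-≤-trans C<a+s (ℤ.+-monoˡ-≤ (ℤ.+ s) (subst ((ℤ.+ a) ℤ.≤_) (ℤ.pos-* c s) (ℤ.+≤+ a≤cs)))))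
  (below (ℤ.<-≤-trans (subst (ℤ._< (ℤ.+ a) ℤ.+ (ℤ.+ s)) (ℤ.pos-* c s) (ℤ.+<+ cs<a+s)) (ℤ.+-monoˡ-≤ (ℤ.+ s) a≤C)))
  where
  q = (ℤ.+ a) / s
  g = ℤ.gcd (ℤ.+ a) (ℤ.+ s)
  C = ⌈ q ⌉
  C-scaled : (C ℤ.* ↧ q) ℤ.* g ≡ C ℤ.* (ℤ.+ s)
  C-scaled = trans (ℤ.*-assoc C (↧ q) g) (cong (C ℤ.*_) (ℚ.↧-/ (ℤ.+ a) s))
  g>0 : ℤ.Positive g
  g>0 with g in eq
  -- `↧ q` times `g` is `s`, which is not zero.
  ... | ℤ.+ zero  with () ← trans (sym (trans (cong (↧ q ℤ.*_) eq) (ℤ.*-zeroʳ (↧ q)))) (ℚ.↧-/ (ℤ.+ a) s)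
  ... | ℤ.+ suc _ = _
  ... | ℤ.-[1+ _ ] with () ← eq
  instance
    g-pos : ℤ.Positive g
    g-pos = g>0
    g-nonNeg : ℤ.NonNegative g
    g-nonNeg = _
  a≤C : (ℤ.+ a) ℤ.≤ C ℤ.* (ℤ.+ s)
  a≤C = subst₂ ℤ._≤_ (ℚ.↥-/ (ℤ.+ a) s) C-scaled (ℤ.*-monoʳ-≤-nonNeg g (proj₁ (⌈⌉-bounds q)))
  C<a+s : C ℤ.* (ℤ.+ s) ℤ.< (ℤ.+ a) ℤ.+ (ℤ.+ s)
  C<a+s = subst₂ ℤ._<_ C-scaled
    (trans (ℤ.*-distribʳ-+ g (↥ q) (↧ q)) (cong₂ ℤ._+_ (ℚ.↥-/ (ℤ.+ a) s) (ℚ.↧-/ (ℤ.+ a) s)))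
    (ℤ.*-monoʳ-<-pos g (proj₂ (⌈⌉-bounds q)))
  below : ∀ {x y} → x ℤ.* (ℤ.+ s) ℤ.< y ℤ.* (ℤ.+ s) ℤ.+ (ℤ.+ s) → x ℤ.≤ y
  below {x} {y} lt = subst (x ℤ.≤_) (ℤ.pred-suc y) (ℤ.i<j⇒i≤pred[j] {x} {ℤ.suc y}
    (ℤ.*-cancelʳ-<-nonNeg {x} {ℤ.suc y} (ℤ.+ s) (subst (x ℤ.* (ℤ.+ s) ℤ.<_)
      (trans (ℤ.+-comm (y ℤ.* (ℤ.+ s)) (ℤ.+ s)) (sym (ℤ.suc-* y (ℤ.+ s)))) lt)))

-- Transfers statements about normalised fractions to unnormalised ones, where they become
-- statements about integers without a gcd.
toℚᵘ-/ : ∀ z s → toℚᵘ (z / suc s) ℚᵘ.≃ mkℚᵘ z s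
toℚᵘ-/ z s = ℚ.toℚᵘ-fromℚᵘ (mkℚᵘ z s)

/1-* : ∀ z w → (z / 1) ℚ.* (w / 1) ≡ (z ℤ.* w) / 1
/1-* z w = ℚ.toℚᵘ-injective (ℚᵘ.≃-trans (ℚ.toℚᵘ-homo-* (z / 1) (w / 1))
  (ℚᵘ.≃-trans (ℚᵘ.*-cong (toℚᵘ-/ z 0) (toℚᵘ-/ w 0)) (ℚᵘ.≃-sym (toℚᵘ-/ (z ℤ.* w) 0))))

/1-+ : ∀ z w → (z / 1) ℚ.+ (w / 1) ≡ (z ℤ.+ w) / 1
/1-+ z w = ℚ.toℚᵘ-injective (ℚᵘ.≃-trans (ℚ.toℚᵘ-homo-+ (z / 1) (w / 1))
  (ℚᵘ.≃-trans (ℚᵘ.+-cong (toℚᵘ-/ z 0) (toℚᵘ-/ w 0)) (ℚᵘ.≃-trans (*≡* (identity z w)) (ℚᵘ.≃-sym (toℚᵘ-/ (z ℤ.+ w) 0)))))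
  where
  identity : ∀ z w → (z ℤ.* (ℤ.+ 1) ℤ.+ w ℤ.* (ℤ.+ 1)) ℤ.* (ℤ.+ 1) ≡ (z ℤ.+ w) ℤ.* (ℤ.+ 1)
  identity = ℤ-Solver.solve-∀

/s*s : ∀ z s → (z / suc s) ℚ.* ((ℤ.+ suc s) / 1) ≡ z / 1
/s*s z s = ℚ.toℚᵘ-injective (ℚᵘ.≃-trans (ℚ.toℚᵘ-homo-* (z / suc s) ((ℤ.+ suc s) / 1))
  (ℚᵘ.≃-trans (ℚᵘ.*-cong (toℚᵘ-/ z s) (toℚᵘ-/ (ℤ.+ suc s) 0))
    (ℚᵘ.≃-trans (*≡* (trans (ℤ.*-identityʳ _) (cong (λ i → z ℤ.* (ℤ.+ i)) (sym (*-identityʳ (suc s))))))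
      (ℚᵘ.≃-sym (toℚᵘ-/ z 0)))))

/1-mono-< : ∀ {z w} → z ℤ.< w → (z / 1) ℚ.< (w / 1)
/1-mono-< {z} {w} z<w = ℚ.toℚᵘ-cancel-< (ℚᵘ.<-respˡ-≃ (ℚᵘ.≃-sym (toℚᵘ-/ z 0)) (ℚᵘ.<-respʳ-≃ (ℚᵘ.≃-sym (toℚᵘ-/ w 0))
  (*<* (subst₂ ℤ._<_ (sym (ℤ.*-identityʳ z)) (sym (ℤ.*-identityʳ w)) z<w))))

/1-cancel-< : ∀ {z w} → (z / 1) ℚ.< (w / 1) → z ℤ.< w
/1-cancel-< {z} {w} z<w
  with *<* z<w′ ← ℚᵘ.<-respˡ-≃ (toℚᵘ-/ z 0) (ℚᵘ.<-respʳ-≃ (toℚᵘ-/ w 0) (ℚ.toℚᵘ-mono-< z<w))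
  = subst₂ ℤ._<_ (ℤ.*-identityʳ z) (ℤ.*-identityʳ w) z<w′

/1-injective : ∀ {z w} → z / 1 ≡ w / 1 → z ≡ w
/1-injective {z} {w} eq with *≡* e ← ℚ./-injective-≃ (mkℚᵘ z 0) (mkℚᵘ w 0) eq =
  trans (sym (ℤ.*-identityʳ z)) (trans e (ℤ.*-identityʳ w))

/1-positive : ∀ s → ℚ.Positive ((ℤ.+ suc s) / 1)
/1-positive s = ℚ.positive (/1-mono-< {ℤ.+ 0} {ℤ.+ suc s} (ℤ.+<+ (s≤s z≤n)))

/≡/1⇒≡* : ∀ {a s z} → a / suc s ≡ z / 1 → a ≡ z ℤ.* (ℤ.+ suc s)
/≡/1⇒≡* {a} {s} {z} eq = /1-injective (trans (sym (/s*s a s)) (trans (cong (ℚ._* ((ℤ.+ suc s) / 1)) eq) (/1-* z (ℤ.+ suc s))))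

≡*⇒/≡/1 : ∀ {a s z} → a ≡ z ℤ.* (ℤ.+ suc s) → a / suc s ≡ z / 1
≡*⇒/≡/1 {a} {s} {z} eq = ℚ.toℚᵘ-injective (ℚᵘ.≃-trans (toℚᵘ-/ a s) (ℚᵘ.≃-trans
  (*≡* (trans (ℤ.*-identityʳ a) eq)) (ℚᵘ.≃-sym (toℚᵘ-/ z 0))))

/1<*/⁺ : ∀ {x y a s} → x ℤ.* (ℤ.+ suc s) ℤ.< y ℤ.* a → (x / 1) ℚ.< (y / 1) ℚ.* (a / suc s)
/1<*/⁺ {x} {y} {a} {s} lt = ℚ.*-cancelʳ-<-nonNeg ι {{ℚ.pos⇒nonNeg ι {{/1-positive s}}}} (subst₂ ℚ._<_
    (sym (/1-* x (ℤ.+ suc s)))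
    (sym (trans (ℚ.*-assoc (y / 1) (a / suc s) ι) (trans (cong ((y / 1) ℚ.*_) (/s*s a s)) (/1-* y a))))
    (/1-mono-< lt))
  where ι = (ℤ.+ suc s) / 1

/1<*/⁻ : ∀ {x y a s} → (x / 1) ℚ.< (y / 1) ℚ.* (a / suc s) → x ℤ.* (ℤ.+ suc s) ℤ.< y ℤ.* a
/1<*/⁻ {x} {y} {a} {s} lt = /1-cancel-< (subst₂ ℚ._<_
    (/1-* x (ℤ.+ suc s))
    (trans (ℚ.*-assoc (y / 1) (a / suc s) ι) (trans (cong ((y / 1) ℚ.*_) (/s*s a s)) (/1-* y a)))
    (ℚ.*-monoˡ-<-pos ι {{/1-positive s}} lt))
  where ι = (ℤ.+ suc s) / 1

*<⇒<÷ : ∀ x y p .{{_ : ℚ.NonZero p}} → ℚ.Positive p → x ℚ.* p ℚ.< y → x ℚ.< y ℚ.÷ p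
*<⇒<÷ x y p pos lt = subst (ℚ._< y ℚ.÷ p)
  (trans (ℚ.*-assoc x p (ℚ.1/ p)) (trans (cong (x ℚ.*_) (ℚ.*-inverseʳ p)) (ℚ.*-identityʳ x)))
  (ℚ.*-monoˡ-<-pos p⁻¹ {{ℚ.1/pos⇒pos p {{pos}}}} lt)
  where
  p⁻¹ : ℚ
  p⁻¹ = ℚ.1/ p

-- j < (q - 1) / (C - q) amounts to j C + 1 < (j + 1) q.
<÷⁺ : ∀ j C q .{{_ : ℚ.NonZero (C ℚ.- q)}} → q ℚ.< C → j ℚ.* C ℚ.+ 1ℚ ℚ.< (j ℚ.+ 1ℚ) ℚ.* q →
  j ℚ.< (q ℚ.- 1ℚ) ℚ.÷ (C ℚ.- q)
<÷⁺ j C q q<C lt = *<⇒<÷ j (q ℚ.- 1ℚ) (C ℚ.- q)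
  (ℚ.positive (subst (ℚ._< C ℚ.- q) (ℚ.+-inverseʳ q) (ℚ.+-monoˡ-< (ℚ.- q) q<C)))
  (subst₂ ℚ._<_ (left j C q) (right j q) (ℚ.+-monoˡ-< (ℚ.- (j ℚ.* q) ℚ.- 1ℚ) lt))
  where
  open +-*-Solver
  left : ∀ j C q → (j ℚ.* C ℚ.+ 1ℚ) ℚ.+ (ℚ.- (j ℚ.* q) ℚ.- 1ℚ) ≡ j ℚ.* (C ℚ.- q)
  left = solve 3 (λ j C q → (j :* C :+ con 1ℚ) :+ (:- (j :* q) :- con 1ℚ) := j :* (C :- q)) refl
  right : ∀ j q → (j ℚ.+ 1ℚ) ℚ.* q ℚ.+ (ℚ.- (j ℚ.* q) ℚ.- 1ℚ) ≡ q ℚ.- 1ℚ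
  right = solve 2 (λ j q → (j :+ con 1ℚ) :* q :+ (:- (j :* q) :- con 1ℚ) := q :- con 1ℚ) refl

//<1⁺ : ∀ {z w s} → z ℤ.< w ℤ.* (ℤ.+ suc s) → (z / suc s) ℚ.< (w / 1)
//<1⁺ {z} {w} {s} lt = ℚ.*-cancelʳ-<-nonNeg ι {{ℚ.pos⇒nonNeg ι {{/1-positive s}}}}
  (subst₂ ℚ._<_ (sym (/s*s z s)) (sym (/1-* w (ℤ.+ suc s))) (/1-mono-< lt))
  where ι = (ℤ.+ suc s) / 1

-- Chromatic number and clique number of a finite graph

∈colourClass⁺ : ∀ {n c} (G : Graph n) (f : Fin n → Fin c) {x i} → f x ≡ i → x ∈ colourClass G f i
∈colourClass⁺ G f {x} {i} fx≡i = lookup⇒[]= x _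
  (trans (lookup∘tabulate _ x) (dec-true (f x ≟ᶠ i) fx≡i))

∈colourClass⁻ : ∀ {n c} (G : Graph n) (f : Fin n → Fin c) {x i} → x ∈ colourClass G f i → f x ≡ i
∈colourClass⁻ G f {x} {i} x∈ = toTrue (f x ≟ᶠ i) (trans (sym (lookup∘tabulate _ x)) ([]=⇒lookup x∈))
  where
  toTrue : ∀ {P : Set} (P? : Dec P) → does P? ≡ true → P
  toTrue (yes p) _ = p

module _ {n : ℕ} (G : Graph n) where
  open Graph G

  -- Fixing the length makes the search finite. The predicate is on vertex lists so that the
  -- recursion can absorb the first vertex into it.
  walkOfLength? : ∀ {P : List (Fin n) → Set} → (∀ l → Dec (P l)) → ∀ ℓ u v →
    Dec (Σ[ w ∈ Walk G u v ] (length w ≡ ℓ × P (vertices w)))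
  walkOfLength? P? zero u v with u ≟ᶠ v
  ... | no  u≢v  = no λ { (ε , _) → u≢v refl ; (_ ◅ _ , () , _) }
  ... | yes refl = map′ (λ p → ε , refl , p) (λ { (ε , _ , p) → p ; (_ ◅ _ , () , _) }) (P? (u ∷ []))
  walkOfLength? P? (suc ℓ) u v = map′
    (λ (x , a , w , e , p) → a ◅ w , cong suc e , p)
    (λ { (ε , () , _) ; (_◅_ {j = x} a w , e , p) → x , a , w , suc-injective e , p })
    (any? λ x → adj? u x ×-dec walkOfLength? (λ l → P? (u ∷ l)) ℓ x v)

  Covers : ℕ → Subset n → Set
  Covers d T = ∃[ u ] ∃[ v ] Σ[ w ∈ Walk G u v ] (IsShortestPath G w × length w ≤ d × T ⊆ vertexSet w)

  unique? : (l : List (Fin n)) → Dec (Unique l)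
  unique? = allPairs? λ x y → ¬? (x ≟ᶠ y)

  paths≥? : ∀ u v ℓ → Dec (∀ (w : Walk G u v) → IsPath w → ℓ ≤ length w)
  paths≥? u v ℓ with anyUpTo? (λ i → walkOfLength? unique? i u v) ℓ
  ... | yes (_ , i<ℓ , w , e , p) = no λ ≥ℓ → <⇒≱ i<ℓ (≤-trans (≥ℓ w p) (≤-reflexive e))
  ... | no ∄w = yes λ w p → ≮⇒≥ λ w<ℓ → ∄w (length w , w<ℓ , w , refl , p)

  covers? : ∀ d T → Dec (Covers d T)
  covers? d T = any? λ u → any? λ v → covered? u v
    where
    covered? : ∀ u v → Dec (Σ[ w ∈ Walk G u v ] (IsShortestPath G w × length w ≤ d × T ⊆ vertexSet w))
    covered? u v with anyUpTo? (λ ℓ → paths≥? u v ℓ ×-dec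
                                  walkOfLength? (λ l → unique? l ×-dec (T ⊆? fromList l)) ℓ u v) (suc d)
    ... | yes (_ , s≤s ℓ≤d , min , w , refl , p , T⊆w) = yes (w , (p , (w , p , refl) , min) , ℓ≤d , T⊆w)
    ... | no ∄ℓ = no λ (w , (p , _ , min) , w≤d , T⊆w) →
      ∄ℓ (length w , s≤s w≤d , min , w , refl , p , T⊆w)

  -- Decidability is what allows the clique number to be found by search, constructively.
  clique? : ∀ k d S → Dec (Clique G k d S)
  clique? k d S with anySubset? (λ T → (T ⊆? S) ×-dec ((∣ T ∣ ≟ k) ×-dec ¬? (covers? d T)))
  ... | yes (T , T⊆S , T≡k , ¬cov) = no λ cl → ¬cov (cl T T⊆S T≡k)
  ... | no ∄T = yes λ T T⊆S T≡k → decidable-stable (covers? d T) λ ¬cov → ∄T (T , T⊆S , T≡k , ¬cov)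

  cliqueNumber : ∀ k d S → Clique G k d S → ∃[ ω ] IsCliqueNumber G k d ω
  cliqueNumber k d S cl =
    let ω , attained , _ , max = greatest (λ ω → ∃[ S ] (Clique G k d S × ∣ S ∣ ≡ ω))
          (λ ω → anySubset? λ S → clique? k d S ×-dec (∣ S ∣ ≟ ω)) n ∣ S ∣ (∣p∣≤n S) (S , cl , refl)
    in ω , attained , λ S′ cl′ → max ∣ S′ ∣ (∣p∣≤n S′) (S′ , cl′ , refl)

  -- Any `suc s` elements of the intersection would lie on one short shortest path, because `S` is a
  -- clique, and that path would meet `X` too often.
  clique∩independent≤ : ∀ {s d S X} → Clique G (suc s) d S → Independent G (suc s) d X → ∣ S ∩ X ∣ ≤ s
  clique∩independent≤ {s} {d} {S} {X} cl ind = ≮⇒≥ λ s<S∩X →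
    let T , _ , T⊆S∩X , T≡k = interpolate (suc s) ⊥ (S ∩ X) (⊆-min (S ∩ X))
          (≤-trans (≤-reflexive (∣⊥∣≡0 n)) z≤n) s<S∩X
        u , v , w , sp , w≤d , T⊆w = cl T (λ x∈T → proj₁ (x∈p∩q⁻ S X (T⊆S∩X x∈T))) T≡k
    in <⇒≱ (ind w sp w≤d) (≤-trans (≤-reflexive (sym T≡k))
         (p⊆q⇒∣p∣≤∣q∣ λ x∈T → x∈p∩q⁺ (proj₂ (x∈p∩q⁻ S X (T⊆S∩X x∈T)) , T⊆w x∈T)))

  clique≤colours*s : ∀ {s d c S} → Clique G (suc s) d S → Colourable G (suc s) d c → ∣ S ∣ ≤ c * s
  clique≤colours*s {s} {d} {c} {S} cl (f , ind) = covered⇒∣p∣≤ c s (λ i → S ∩ colourClass G f i)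
    (λ {x} x∈S → f x , x∈p∩q⁺ (x∈S , ∈colourClass⁺ G f refl)) (λ i → clique∩independent≤ cl (ind i))

  -- A colouring and a clique that is too large for one colour fewer pin down both invariants.
  colouring∧clique⇒χ≡⌈ω/s⌉ : ∀ {s d c} .{{_ : NonZero s}} S → Colourable G (suc s) d (suc c) →
    Clique G (suc s) d S → c * s < ∣ S ∣ →
    ∃[ χ ] ∃[ ω ] (IsChromaticNumber G (suc s) d χ × IsCliqueNumber G (suc s) d ω × ℤ.+ χ ≡ ⌈ (ℤ.+ ω) / s ⌉)
  colouring∧clique⇒χ≡⌈ω/s⌉ {s} {d} {c} S col cl cs<S
    with ω , attained@(S′ , cl′ , S′≡ω) , max ← cliqueNumber (suc s) d S cl
    = suc c , ω ,
      (s≤s z≤n , col , λ c′ _ col′ →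
        *-cancelʳ-< s c c′ (≤-trans cs<S (clique≤colours*s cl col′))) ,
      (attained , max) ,
      sym (⌈/⌉-unique ω s (suc c) (subst (_≤ suc c * s) S′≡ω (clique≤colours*s cl′ col))
        (subst (suc c * s <_) (+-comm s ω) (+-monoʳ-< s (≤-trans cs<S (max S cl)))))

-- Residues

%≡⇒≡+* : ∀ n {P Q} .{{_ : NonZero n}} → P % n ≡ Q % n → P ≤ Q → ∃[ j ] Q ≡ P + j * n
%≡⇒≡+* n {P} {Q} P≡Q P≤Q = Q /ℕ n ∸ P /ℕ n , (begin
  Q                                             ≡⟨ m≡m%n+[m/n]*n Q n ⟩
  Q % n + Q /ℕ n * n                             ≡⟨ cong₂ (λ r q → r + q * n) (sym P≡Q) (sym (m+[n∸m]≡n (/-monoˡ-≤ n P≤Q))) ⟩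
  P % n + (P /ℕ n + (Q /ℕ n ∸ P /ℕ n)) * n         ≡⟨ cong (P % n +_) (*-distribʳ-+ n (P /ℕ n) _) ⟩
  P % n + (P /ℕ n * n + (Q /ℕ n ∸ P /ℕ n) * n)     ≡⟨ +-assoc (P % n) _ _ ⟨
  P % n + P /ℕ n * n + (Q /ℕ n ∸ P /ℕ n) * n       ≡⟨ cong (_+ (Q /ℕ n ∸ P /ℕ n) * n) (m≡m%n+[m/n]*n P n) ⟨
  P + (Q /ℕ n ∸ P /ℕ n) * n                       ∎)
  where open ≡-Reasoning

%≢ : ∀ n {P Q} .{{_ : NonZero n}} → P < Q → Q < P + n → P % n ≢ Q % n
%≢ n {P} P<Q Q<P+n P≡Q with %≡⇒≡+* n P≡Q (<⇒≤ P<Q)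
... | zero  , refl = <-irrefl (sym (+-identityʳ P)) P<Q
... | suc j , refl = <⇒≱ Q<P+n (+-monoʳ-≤ P (m≤m+n n (j * n)))

%-suc : ∀ P n .{{_ : NonZero n}} → suc P % n ≡ suc (P % n) % n
%-suc P n = trans (cong (λ z → suc z % n) (m≡m%n+[m/n]*n P n)) ([m+kn]%n≡m%n (suc (P % n)) (P /ℕ n) n)

%-+ˡ : ∀ P i n .{{_ : NonZero n}} → (P % n + i) % n ≡ (P + i) % n
%-+ˡ P i n = trans (%-distribˡ-+ (P % n) i n)
  (trans (cong (λ z → (z + i % n) % n) (m%n%n≡m%n P n)) (sym (%-distribˡ-+ P i n)))

%-cong-+ : ∀ {P Q} i n .{{_ : NonZero n}} → P % n ≡ Q % n → (P + i) % n ≡ (Q + i) % n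
%-cong-+ {P} {Q} i n P≡Q = trans (sym (%-+ˡ P i n)) (trans (cong (λ z → (z + i) % n) P≡Q) (%-+ˡ Q i n))

%-cong-* : ∀ {P Q} t n .{{_ : NonZero n}} → P % n ≡ Q % n → (P * t) % n ≡ (Q * t) % n
%-cong-* {P} {Q} t n P≡Q = trans (%-distribˡ-* P t n)
  (trans (cong (λ z → (z * (t % n)) % n) P≡Q) (sym (%-distribˡ-* Q t n)))

-- Used to lift a vertex into a prescribed turn of the cycle. The representative with the same
-- quotient as `Q` is taken if it is not below `Q`, and the next one otherwise.
residueFrom : ∀ n Q r .{{_ : NonZero n}} → r < n → ∃[ R ] (Q ≤ R × R < Q + n × R % n ≡ r)
residueFrom n Q r r<n with Q % n ≤? r
... | yes Q%n≤r = r + Q /ℕ n * n ,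
  ≤-trans (≤-reflexive (m≡m%n+[m/n]*n Q n)) (+-monoˡ-≤ (Q /ℕ n * n) Q%n≤r) ,
  subst (_< Q + n) (+-comm (Q /ℕ n * n) r) (+-mono-≤-< (m/n*n≤m Q n) r<n) ,
  trans ([m+kn]%n≡m%n r (Q /ℕ n) n) (m<n⇒m%n≡m r<n)
... | no Q%n≰r = r + suc (Q /ℕ n) * n ,
  ≤-trans (≤-reflexive (m≡m%n+[m/n]*n Q n))
    (≤-trans (+-monoˡ-≤ (Q /ℕ n * n) (<⇒≤ (m%n<n Q n))) (m≤n+m (suc (Q /ℕ n) * n) r)) ,
  subst (r + suc (Q /ℕ n) * n <_)
    (trans (cong (Q % n +_) (+-comm n (Q /ℕ n * n))) (trans (sym (+-assoc (Q % n) (Q /ℕ n * n) n))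
      (cong (_+ n) (sym (m≡m%n+[m/n]*n Q n))))) (+-monoˡ-< (suc (Q /ℕ n) * n) (≰⇒> Q%n≰r)) ,
  trans ([m+kn]%n≡m%n r (suc (Q /ℕ n)) n) (m<n⇒m%n≡m r<n)

-- Cut ℕ at the numbers ⌈i N / t⌉ into blocks of average length N / t: then x lies in block number
-- (x * t) /ℕ N, at position ((x * t) % N) /ℕ t of it.
module _ (N t : ℕ) .{{_ : NonZero N}} .{{_ : NonZero t}} where

  block position : ℕ → ℕ
  block P    = P * t /ℕ N
  position P = P * t % N /ℕ t

  private
    -- Equal positions put both remainders in the same interval of length `t`.
    remainder< : ∀ {P Q} → position P ≡ position Q → P * t % N < Q * t % N + t
    remainder< {P} {Q} e = begin-strict
      P * t % N                             ≡⟨ m≡m%n+[m/n]*n (P * t % N) t ⟩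
      P * t % N % t + position P * t        <⟨ +-monoˡ-< (position P * t) (m%n<n (P * t % N) t) ⟩
      t + position P * t                    ≡⟨ cong (λ z → t + z * t) e ⟩
      t + position Q * t                    ≤⟨ +-monoʳ-≤ t (m/n*n≤m (Q * t % N) t) ⟩
      t + Q * t % N                         ≡⟨ +-comm t _ ⟩
      Q * t % N + t                         ∎
      where open ≤-Reasoning

  -- With equal blocks, `P * t` and `Q * t` differ only in their remainders, hence by less than `t`.
  position-block-injective : ∀ {P Q} → position P ≡ position Q → block P ≡ block Q → P ≡ Q
  position-block-injective {P} {Q} p b = ≤-antisym (le P Q p b) (le Q P (sym p) (sym b))
    where
    le : ∀ P Q → position P ≡ position Q → block P ≡ block Q → P ≤ Q
    le P Q p b = ≤-pred (*-cancelʳ-< t P (suc Q) (begin-strict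
      P * t                         ≡⟨ m≡m%n+[m/n]*n (P * t) N ⟩
      P * t % N + block P * N       <⟨ +-monoˡ-< (block P * N) (remainder< {P} {Q} p) ⟩
      Q * t % N + t + block P * N   ≡⟨ cong (λ z → Q * t % N + t + z * N) b ⟩
      Q * t % N + t + block Q * N   ≡⟨ cong (_+ block Q * N) (+-comm (Q * t % N) t) ⟩
      t + Q * t % N + block Q * N   ≡⟨ +-assoc t _ _ ⟩
      t + (Q * t % N + block Q * N) ≡⟨ cong (t +_) (m≡m%n+[m/n]*n (Q * t) N) ⟨
      t + Q * t                     ∎))
      where open ≤-Reasoning

  -- Here the density condition enters: `s` further blocks contribute `N * s`, so at least `t * m`,
  -- while the remainders distort the comparison by less than `t`, which cancelling `t` absorbs.
  position-block-spread : ∀ {P Q s m} → t * m ≤ N * s → position P ≡ position Q → block P + s ≤ block Q → P + m ≤ Q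
  position-block-spread {P} {Q} {s} {m} tm≤Ns p b = ≤-pred (*-cancelʳ-< t (P + m) (suc Q) (begin-strict
    (P + m) * t                                 ≡⟨ *-distribʳ-+ t P m ⟩
    P * t + m * t                               ≡⟨ cong (P * t +_) (*-comm m t) ⟩
    P * t + t * m                               ≤⟨ +-monoʳ-≤ (P * t) tm≤Ns ⟩
    P * t + N * s                               ≡⟨ cong₂ _+_ (m≡m%n+[m/n]*n (P * t) N) (*-comm N s) ⟩
    P * t % N + block P * N + s * N             ≡⟨ +-assoc (P * t % N) _ _ ⟩
    P * t % N + (block P * N + s * N)           ≡⟨ cong (P * t % N +_) (*-distribʳ-+ N (block P) s) ⟨
    P * t % N + (block P + s) * N               <⟨ +-mono-<-≤ (remainder< {P} {Q} p) (*-monoˡ-≤ N b) ⟩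
    Q * t % N + t + block Q * N                 ≡⟨ cong (_+ block Q * N) (+-comm (Q * t % N) t) ⟩
    t + Q * t % N + block Q * N                 ≡⟨ +-assoc t _ _ ⟩
    t + (Q * t % N + block Q * N)               ≡⟨ cong (t +_) (m≡m%n+[m/n]*n (Q * t) N) ⟨
    t + Q * t                                   ∎))
    where open ≤-Reasoning

  position< : ∀ {c} P → N ≤ c * t → position P < c
  position< P N≤ct = m<n*o⇒m/o<n (≤-trans (m%n<n (P * t) N) N≤ct)

-- Walks along sequences of vertices

module _ {n : ℕ} (G : Graph n) where
  open Graph G

  end∈vertices : ∀ {u v} (w : Walk G u v) → v ∈ˡ vertices w
  end∈vertices ε       = here refl
  end∈vertices (_ ◅ w) = there (end∈vertices w)

  sequenceWalk : (x : ℕ → Fin n) → ∀ ℓ → (∀ i → i < ℓ → Adj (x i) (x (suc i))) → Walk G (x 0) (x ℓ)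
  sequenceWalk x zero    adj = ε
  sequenceWalk x (suc ℓ) adj = adj 0 (s≤s z≤n) ◅ sequenceWalk (x ∘ suc) ℓ (λ i i<ℓ → adj (suc i) (s≤s i<ℓ))

  length-sequenceWalk : ∀ x ℓ adj → length (sequenceWalk x ℓ adj) ≡ ℓ
  length-sequenceWalk x zero    adj = refl
  length-sequenceWalk x (suc ℓ) adj = cong suc (length-sequenceWalk (x ∘ suc) ℓ _)

  vertices-sequenceWalk : ∀ x ℓ adj → vertices (sequenceWalk x ℓ adj) ≡ applyUpTo x (suc ℓ)
  vertices-sequenceWalk x zero    adj = refl
  vertices-sequenceWalk x (suc ℓ) adj = cong (x 0 ∷_) (vertices-sequenceWalk (x ∘ suc) ℓ _)

  sequenceWalk-isPath : ∀ x ℓ adj → (∀ {i j} → i < j → j ≤ ℓ → x i ≢ x j) → IsPath (sequenceWalk x ℓ adj)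
  sequenceWalk-isPath x ℓ adj distinct = subst Unique (sym (vertices-sequenceWalk x ℓ adj))
    (Unique.applyUpTo⁺₁ x (suc ℓ) λ i<j j<1+ℓ → distinct i<j (≤-pred j<1+ℓ))

-- Induced subgraphs of cycles

module InducedCycle {n k : ℕ} (3≤n : 3 ≤ n) .{{_ : NonZero n}} .{{_ : NonZero k}} (f : Fin k ↣ Fin n) where
  open Injection f using (to; injective)

  H : Graph k
  H = induced (cycle n 3≤n) f

  -- Walks are unrolled along ℕ, which covers the cycle by P ↦ P % n.
  Lift : ℕ → Fin k → Set
  Lift P x = P % n ≡ toℕ (to x)

  -- Positions over the vertices kept by `f`; the others are holes at which the cycle can be cut
  -- open.
  Occupied : ℕ → Set
  Occupied P = ∃[ x ] Lift P x

  occupied? : ∀ P → Dec (Occupied P)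
  occupied? P = any? λ x → P % n ≟ toℕ (to x)

  occupied-cong : ∀ {P Q} → P % n ≡ Q % n → Occupied P → Occupied Q
  occupied-cong P≡Q (x , Px) = x , trans (sym P≡Q) Px

  lift-injective : ∀ {P x y} → Lift P x → Lift P y → x ≡ y
  lift-injective Px Py = injective (toℕ-injective (trans (sym Px) Py))

  suc-%-cases : ∀ P → (suc P % n ≡ suc (P % n)) ⊎ (suc (P % n) ≡ n × suc P % n ≡ 0)
  suc-%-cases P with suc (P % n) ≟ n
  ... | yes e = inj₂ (e , trans (%-suc P n) (trans (cong (_% n) e) (n%n≡0 n)))
  ... | no  e = inj₁ (trans (%-suc P n) (m<n⇒m%n≡m (≤∧≢⇒< (m%n<n P n) e)))

  next⇒lift-suc : ∀ {P x y} → Next (to x) (to y) → Lift P x → Lift (suc P) y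
  next⇒lift-suc {P} (inj₁ 1+x≡y) Px with suc-%-cases P
  ... | inj₁ e       = trans e (trans (cong suc Px) 1+x≡y)
  ... | inj₂ (e , _) = contradiction (trans (sym 1+x≡y) (trans (cong suc (sym Px)) e)) (<⇒≢ (toℕ<n _))
  next⇒lift-suc {P} (inj₂ (1+x≡n , y≡0)) Px with suc-%-cases P
  ... | inj₁ e       = contradiction (trans e (trans (cong suc Px) 1+x≡n)) (<⇒≢ (m%n<n (suc P) n))
  ... | inj₂ (_ , e) = trans e (sym y≡0)

  lift-suc⇒next : ∀ {P x y} → Lift P x → Lift (suc P) y → Next (to x) (to y)
  lift-suc⇒next {P} Px 1+Py with suc-%-cases P
  ... | inj₁ e        = inj₁ (trans (cong suc (sym Px)) (trans (sym e) 1+Py))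
  ... | inj₂ (e , e′) = inj₂ (trans (cong suc (sym Px)) e , trans (sym 1+Py) e′)

  next⇒lift-pred : ∀ {P x y} → Next (to x) (to y) → Lift (suc P) y → Lift P x
  next⇒lift-pred {P} (inj₁ 1+x≡y) Py with suc-%-cases P
  ... | inj₁ e       = suc-injective (trans (sym e) (trans Py (sym 1+x≡y)))
  ... | inj₂ (_ , e) = contradiction (trans (sym e) (trans Py (sym 1+x≡y))) λ ()
  next⇒lift-pred {P} (inj₂ (1+x≡n , y≡0)) Py with suc-%-cases P
  ... | inj₁ e       = contradiction (trans (sym e) (trans Py y≡0)) λ ()
  ... | inj₂ (e , _) = suc-injective (trans e (sym 1+x≡n))

  -- An interval around the starting position `P` that holds a lift of every vertex of `w`. By
  -- `narrow` it is no longer than the walk, and by `filled` it contains no hole.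
  record Window {u v} (w : Walk H u v) (P : ℕ) : Set where
    field
      lo hi  : ℕ
      lo≤P   : lo ≤ P
      P≤hi   : P ≤ hi
      narrow : hi ≤ lo + length w
      lifts  : ∀ {x} → x ∈ˡ vertices w → ∃[ Q ] (lo ≤ Q × Q ≤ hi × Lift Q x)
      filled : ∀ Q → lo ≤ Q → Q ≤ hi → Occupied Q

  -- The bound `length w ≤ P` leaves room below `P` for backward steps. When the start is outside
  -- the interval of the remaining walk, it is adjacent to it, and the extra step pays for including
  -- it.
  window : ∀ {u v} (w : Walk H u v) P → Lift P u → length w ≤ P → Window w P
  window ε P Pu _ = record
    { lo = P ; hi = P ; lo≤P = ≤-refl ; P≤hi = ≤-refl ; narrow = m≤m+n P 0
    ; lifts = λ { (here refl) → P , ≤-refl , ≤-refl , Pu }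
    ; filled = λ Q P≤Q Q≤P → subst Occupied (≤-antisym P≤Q Q≤P) (_ , Pu) }
  window (inj₁ u→v ◅ w) P Pu len with window w (suc P) (next⇒lift-suc u→v Pu) (m≤n⇒m≤1+n (<⇒≤ len))
  ... | record { lo = lo ; hi = hi ; lo≤P = lo≤P ; P≤hi = P≤hi ; narrow = narrow ; lifts = lifts ; filled = filled }
    with lo ≤? P
  ... | yes lo≤P′ = record
    { lo = lo ; hi = hi ; lo≤P = lo≤P′ ; P≤hi = <⇒≤ P≤hi
    ; narrow = ≤-trans narrow (+-monoʳ-≤ lo (n≤1+n _))
    ; lifts = λ { (here refl) → P , lo≤P′ , <⇒≤ P≤hi , Pu ; (there x∈) → lifts x∈ }
    ; filled = filled }
  ... | no lo≰P = record
    { lo = P ; hi = hi ; lo≤P = ≤-refl ; P≤hi = <⇒≤ P≤hi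
    ; narrow = ≤-trans narrow (≤-trans (+-monoˡ-≤ _ lo≤P) (≤-reflexive (sym (+-suc P _))))
    ; lifts = λ { (here refl) → P , ≤-refl , <⇒≤ P≤hi , Pu
                ; (there x∈) → let Q , lo≤Q , Q≤hi , Qx = lifts x∈
                               in Q , ≤-trans (<⇒≤ (≰⇒> lo≰P)) lo≤Q , Q≤hi , Qx }
    ; filled = λ Q P≤Q Q≤hi → filled′ Q (m≤n⇒m<n∨m≡n P≤Q) Q≤hi }
    where
    filled′ : ∀ Q → P < Q ⊎ P ≡ Q → Q ≤ hi → Occupied Q
    filled′ Q (inj₁ P<Q)  Q≤hi = filled Q (≤-trans lo≤P P<Q) Q≤hi
    filled′ Q (inj₂ refl) Q≤hi = _ , Pu
  window (inj₂ v→u ◅ w) (suc P) Pu (s≤s len) with window w P (next⇒lift-pred v→u Pu) len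
  ... | record { lo = lo ; hi = hi ; lo≤P = lo≤P ; P≤hi = P≤hi ; narrow = narrow ; lifts = lifts ; filled = filled }
    with suc P ≤? hi
  ... | yes P<hi = record
    { lo = lo ; hi = hi ; lo≤P = m≤n⇒m≤1+n lo≤P ; P≤hi = P<hi
    ; narrow = ≤-trans narrow (+-monoʳ-≤ lo (n≤1+n _))
    ; lifts = λ { (here refl) → suc P , m≤n⇒m≤1+n lo≤P , P<hi , Pu ; (there x∈) → lifts x∈ }
    ; filled = filled }
  ... | no P≮hi = record
    { lo = lo ; hi = suc P ; lo≤P = m≤n⇒m≤1+n lo≤P ; P≤hi = ≤-refl
    ; narrow = ≤-trans (s≤s (≤-trans P≤hi narrow)) (≤-reflexive (sym (+-suc lo _)))
    ; lifts = λ { (here refl) → suc P , m≤n⇒m≤1+n lo≤P , ≤-refl , Pu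
                ; (there x∈) → let Q , lo≤Q , Q≤hi , Qx = lifts x∈
                               in Q , lo≤Q , ≤-trans Q≤hi (<⇒≤ (≰⇒> P≮hi)) , Qx }
    ; filled = λ Q lo≤Q Q≤1+P → filled′ Q lo≤Q (m≤n⇒m<n∨m≡n Q≤1+P) }
    where
    filled′ : ∀ Q → lo ≤ Q → Q < suc P ⊎ Q ≡ suc P → Occupied Q
    filled′ Q lo≤Q (inj₁ (s≤s Q≤P)) = filled Q lo≤Q (≤-trans Q≤P P≤hi)
    filled′ Q lo≤Q (inj₂ refl) = _ , Pu

  -- Adding `length w` full turns to `a` creates the room that `window` asks for and stays over the
  -- same vertex.
  startWindow : ∀ {u v} (w : Walk H u v) a → Lift a u → Window w (a + length w * n)
  startWindow w a au = window w _ (trans ([m+kn]%n≡m%n a (length w) n) au)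
    (≤-trans (m≤m*n (length w) n) (m≤n+m _ a))

  lift-toℕ : ∀ x → Lift (toℕ (to x)) x
  lift-toℕ x = m<n⇒m%n≡m (toℕ<n (to x))

-- Arcs and geodesics

module Arcs {n k : ℕ} (3≤n : 3 ≤ n) .{{_ : NonZero n}} .{{_ : NonZero k}} (f : Fin k ↣ Fin n) where
  open Injection f using (to)
  open InducedCycle 3≤n f

  pick : ℕ → Fin k
  pick P with occupied? P
  ... | yes (x , _) = x
  -- An arbitrary vertex over a hole; `pick-lift` speaks of occupied positions only.
  ... | no  _       = fromℕ< (>-nonZero⁻¹ k)

  pick-lift : ∀ {P} → Occupied P → Lift P (pick P)
  pick-lift {P} occ with occupied? P
  ... | yes (_ , Px) = Px
  ... | no  ¬occ     = contradiction occ ¬occ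

  pick-distinct : ∀ {P Q} → Occupied P → Occupied Q → P < Q → Q < P + n → pick P ≢ pick Q
  pick-distinct oP oQ P<Q Q<P+n e = %≢ n P<Q Q<P+n
    (trans (pick-lift oP) (trans (cong (toℕ ∘ to) e) (sym (pick-lift oQ))))

  OccupiedArc : ℕ → ℕ → Set
  OccupiedArc a ℓ = ∀ i → i ≤ ℓ → Occupied (a + i)

  module _ {a ℓ : ℕ} (occ : OccupiedArc a ℓ) (ℓ<n : ℓ < n) where

    arcAdj : ∀ i → i < ℓ → Next (to (pick (a + i))) (to (pick (a + suc i)))
    arcAdj i i<ℓ = lift-suc⇒next {a + i} (pick-lift (occ i (<⇒≤ i<ℓ)))
      (subst (λ z → Lift z (pick (a + suc i))) (+-suc a i) (pick-lift (occ (suc i) i<ℓ)))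

    arcDistinct : ∀ {i j} → i < j → j ≤ ℓ → pick (a + i) ≢ pick (a + j)
    arcDistinct {i} {j} i<j j≤ℓ = pick-distinct (occ i (≤-trans (<⇒≤ i<j) j≤ℓ)) (occ j j≤ℓ) (+-monoʳ-< a i<j)
      (≤-trans (+-monoʳ-< a (≤-trans (s≤s j≤ℓ) ℓ<n)) (+-monoˡ-≤ n (m≤m+n a i)))

    arc : Walk H (pick (a + 0)) (pick (a + ℓ))
    arc = sequenceWalk H (λ i → pick (a + i)) ℓ λ i i<ℓ → inj₁ (arcAdj i i<ℓ)

    length-arc : length arc ≡ ℓ
    length-arc = length-sequenceWalk H _ ℓ _

    arc-isPath : IsPath arc
    arc-isPath = sequenceWalk-isPath H _ ℓ _ arcDistinct

    -- Serves pairs of vertices whose shorter connection runs against the orientation.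
    reverseArc : Walk H (pick (a + ℓ)) (pick (a + (ℓ ∸ ℓ)))
    reverseArc = sequenceWalk H (λ i → pick (a + (ℓ ∸ i))) ℓ λ i i<ℓ → inj₂
      (subst (λ z → Next (to (pick (a + (ℓ ∸ suc i)))) (to (pick (a + z)))) (sym (+-∸-assoc 1 i<ℓ))
        (arcAdj (ℓ ∸ suc i) (≤-trans (≤-reflexive (sym (+-∸-assoc 1 i<ℓ))) (m∸n≤m ℓ i))))

    length-reverseArc : length reverseArc ≡ ℓ
    length-reverseArc = length-sequenceWalk H _ ℓ _

    reverseArc-isPath : IsPath reverseArc
    reverseArc-isPath = sequenceWalk-isPath H _ ℓ _ λ {i} {j} i<j j≤ℓ e →
      arcDistinct (∸-monoʳ-< i<j j≤ℓ) (m∸n≤m ℓ i) (sym e)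

  arcVertices : ℕ → ℕ → List (Fin k)
  arcVertices a ℓ = applyUpTo (λ i → pick (a + i)) (suc ℓ)

  arcSet : ℕ → ℕ → Subset k
  arcSet a ℓ = fromList (arcVertices a ℓ)

  ∈arcSet⁺ : ∀ a ℓ {x} i → OccupiedArc a ℓ → i ≤ ℓ → Lift (a + i) x → x ∈ arcSet a ℓ
  ∈arcSet⁺ a ℓ i occ i≤ℓ x-lift = subst (_∈ arcSet a ℓ) (lift-injective {a + i} (pick-lift (occ i i≤ℓ)) x-lift)
    (∈fromList⁺ (∈-applyUpTo⁺ (λ i → pick (a + i)) (s≤s i≤ℓ)))

  -- A walk from lift a to lift a + ℓ that is shorter than ℓ winds around the cycle the other way.
  shortcut : ∀ {u v} (w : Walk H u v) a ℓ → Lift a u → Lift (a + ℓ) v → ℓ < n → length w < ℓ →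
    ∃[ Q ] (Q + n ≤ a + length w * n + ℓ × a + length w * n ≤ Q + length w ×
            (∀ R → Q ≤ R → R ≤ a + length w * n → Occupied R))
  shortcut {v = v} w a ℓ au a+ℓv ℓ<n w<ℓ
    with record { lo = lo ; hi = hi ; lo≤P = lo≤P ; P≤hi = P≤hi ; narrow = narrow ; lifts = lifts ; filled = filled }
           ← startWindow w a au
    with Q , lo≤Q , Q≤hi , Qv ← lifts (end∈vertices H w)
    = Q , Q+n≤P+ℓ , ≤-trans P≤hi (≤-trans narrow (+-monoˡ-≤ (length w) lo≤Q)) ,
      λ R Q≤R R≤P → filled R (≤-trans lo≤Q Q≤R) (≤-trans R≤P P≤hi)
    where
    P = a + length w * n
    Q<P+ℓ : Q < P + ℓ
    Q<P+ℓ = ≤-<-trans Q≤hi (≤-<-trans narrow (≤-<-trans (+-monoˡ-≤ (length w) lo≤P) (+-monoʳ-< P w<ℓ)))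
    Q≡P+ℓ : Q % n ≡ (P + ℓ) % n
    Q≡P+ℓ = trans Qv (trans (sym a+ℓv) (sym (%-cong-+ ℓ n ([m+kn]%n≡m%n a (length w) n))))
    -- `Q` and `P + ℓ` are congruent and distinct, so they are at least a full turn apart.
    Q+n≤P+ℓ : Q + n ≤ P + ℓ
    Q+n≤P+ℓ with %≡⇒≡+* n Q≡P+ℓ (<⇒≤ Q<P+ℓ)
    ... | zero  , e = contradiction (trans e (+-identityʳ Q)) (λ e′ → <⇒≢ Q<P+ℓ (sym e′))
    ... | suc j , e = ≤-trans (+-monoʳ-≤ Q (m≤m+n n (j * n))) (≤-reflexive (sym e))

  Geodesic : ℕ → ℕ → Set
  Geodesic a ℓ = ∀ {u v} (w : Walk H u v) → Lift a u → Lift (a + ℓ) v → ℓ ≤ length w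

  -- A shorter walk would go the other way round, so that walk and arc together make a full turn;
  -- but their total length is below `ℓ + ℓ`.
  half-geodesic : ∀ a ℓ → ℓ < n → ℓ + ℓ ≤ n → Geodesic a ℓ
  half-geodesic a ℓ ℓ<n 2ℓ≤n w au a+ℓv = ≮⇒≥ λ w<ℓ →
    let Q , Q+n≤P+ℓ , P≤Q+w , _ = shortcut w a ℓ au a+ℓv ℓ<n w<ℓ
    in <⇒≱ (+-monoˡ-< ℓ w<ℓ) (≤-trans 2ℓ≤n (+-cancelˡ-≤ Q n (length w + ℓ)
         (≤-trans Q+n≤P+ℓ (≤-trans (+-monoˡ-≤ ℓ P≤Q+w) (≤-reflexive (+-assoc Q (length w) ℓ))))))

  -- A shorter walk would go the other way round, and then walk and arc together occupy a full turn,
  -- leaving no place for the hole.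
  hole-geodesic : ∀ p₀ → p₀ < n → ¬ Occupied p₀ → ∀ a ℓ → ℓ < n → OccupiedArc a ℓ → Geodesic a ℓ
  hole-geodesic p₀ p₀<n hole a ℓ ℓ<n occ w au a+ℓv = ≮⇒≥ λ w<ℓ →
    let P = a + length w * n
        Q , Q+n≤P+ℓ , _ , filled = shortcut w a ℓ au a+ℓv ℓ<n w<ℓ
        R , Q≤R , R<Q+n , R≡p₀ = residueFrom n Q p₀ p₀<n
        i≤ℓ : R ∸ P ≤ ℓ
        i≤ℓ = ≤-trans (∸-monoˡ-≤ P (≤-trans (<⇒≤ R<Q+n) Q+n≤P+ℓ)) (≤-reflexive (m+n∸m≡n P ℓ))
        occR : Occupied R
        occR = case-≤ R P (filled R Q≤R) λ P≤R → occupied-cong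
          (trans (sym (%-cong-+ (R ∸ P) n ([m+kn]%n≡m%n a (length w) n))) (cong (_% n) (m+[n∸m]≡n P≤R)))
          (occ (R ∸ P) i≤ℓ)
    in hole (occupied-cong (trans R≡p₀ (sym (m<n⇒m%n≡m p₀<n))) occR)
    where
    case-≤ : ∀ {A : Set} R P → (R ≤ P → A) → (P ≤ R → A) → A
    case-≤ R P f g with R ≤? P
    ... | yes p = f p
    ... | no ¬p = g (<⇒≤ (≰⇒> ¬p))

  module _ {a ℓ : ℕ} (occ : OccupiedArc a ℓ) (ℓ<n : ℓ < n) (geo : Geodesic a ℓ) where

    arc-shortest : IsShortestPath H (arc occ ℓ<n)
    arc-shortest = arc-isPath occ ℓ<n , (arc occ ℓ<n , arc-isPath occ ℓ<n , refl) , λ w _ →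
      subst (_≤ length w) (sym (length-arc occ ℓ<n)) (geo w
        (subst (λ z → Lift z (pick (a + 0))) (+-identityʳ a) (pick-lift (occ 0 z≤n))) (pick-lift (occ ℓ ≤-refl)))

    arcSet⊆arc : ∀ {x} → x ∈ arcSet a ℓ → x ∈ vertexSet (arc occ ℓ<n)
    arcSet⊆arc {x} = subst (λ l → x ∈ fromList l) (sym (vertices-sequenceWalk H _ ℓ _))

    arcSet-clique : ∀ κ {d} → ℓ ≤ d → Clique H κ d (arcSet a ℓ)
    arcSet-clique κ ℓ≤d T T⊆arc _ = _ , _ , arc occ ℓ<n , arc-shortest ,
      ≤-trans (≤-reflexive (length-arc occ ℓ<n)) ℓ≤d , λ x∈T → arcSet⊆arc (T⊆arc x∈T)

    ∣arcSet∣ : suc ℓ ≤ ∣ arcSet a ℓ ∣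
    ∣arcSet∣ = ≤-trans (≤-reflexive (sym (length-applyUpTo (λ i → pick (a + i)) (suc ℓ))))
      (length≤∣p∣ (subst Unique (vertices-sequenceWalk H _ ℓ _) (arc-isPath occ ℓ<n)) ∈fromList⁺)

    independent∩arcSet : ∀ {κ d X} → ℓ ≤ d → Independent H κ d X → ∣ X ∩ arcSet a ℓ ∣ < κ
    independent∩arcSet {κ} {d} {X} ℓ≤d ind = ≤-<-trans
      (p⊆q⇒∣p∣≤∣q∣ λ x∈ → let x∈X , x∈arc = x∈p∩q⁻ X (arcSet a ℓ) x∈ in x∈p∩q⁺ (x∈X , arcSet⊆arc x∈arc))
      (ind (arc occ ℓ<n) arc-shortest (≤-trans (≤-reflexive (length-arc occ ℓ<n)) ℓ≤d))

-- Colourings of induced subgraphs of cycles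

module Colourings {n k : ℕ} (3≤n : 3 ≤ n) .{{_ : NonZero n}} .{{_ : NonZero k}} (f : Fin k ↣ Fin n) where
  open Injection f using (to)
  open InducedCycle 3≤n f

  -- Occurrences of one colour lie in distinct blocks, and s blocks have at least m vertices.
  cycle-colourable : ∀ s d t c m .{{_ : NonZero t}} → t * m ≤ n * s → n ≤ c * t →
    (∀ {u v} (w : Walk H u v) → IsShortestPath H w → length w ≤ d → length w < m) → Colourable H (suc s) d c
  cycle-colourable s d t c m tm≤ns n≤ct short = colour , λ γ w sp w≤d → s≤s (few γ w (short w sp w≤d))
    where
    colour : Fin k → Fin c
    colour x = fromℕ< (position< n t {c} (toℕ (to x)) n≤ct)

    -- Positions are `n`-periodic, so every lift of a vertex computes the same colour.
    toℕ-colour : ∀ {Q x} → Lift Q x → toℕ (colour x) ≡ position n t Q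
    toℕ-colour {Q} {x} Qx = trans (toℕ-fromℕ< _)
      (cong (_/ℕ t) (%-cong-* t n (trans (m<n⇒m%n≡m (toℕ<n (to x))) (sym Qx))))

    few : ∀ γ {u v} (w : Walk H u v) → length w < m → ∣ colourClass H colour γ ∩ vertexSet w ∣ ≤ s
    few γ {u} w w<m
      with record { lo = lo ; hi = hi ; narrow = narrow ; lifts = lifts } ← startWindow w (toℕ (to u)) (lift-toℕ u)
      = spread⇒∣p∣≤ s _ R total
          (λ (Q , _ , _ , Qx , x≡γ , i≡) (Q′ , _ , _ , Q′y , y≡γ , i≡′) → lift-injective Qx
            (subst (λ z → Lift z _) (sym (position-block-injective n t
              (same-position Qx Q′y x≡γ y≡γ) (trans (sym i≡) i≡′))) Q′y))
          (λ (Q , lo≤Q , _ , Qx , x≡γ , i≡) (Q′ , _ , Q′≤hi , Q′y , y≡γ , i≡′) → ≰⇒> λ i+s≤j →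
            <⇒≱ (≤-<-trans Q′≤hi (≤-<-trans narrow (+-mono-≤-< lo≤Q w<m)))
              (position-block-spread n t tm≤ns (same-position Qx Q′y x≡γ y≡γ)
                (subst₂ (λ a b → a + s ≤ b) i≡ i≡′ i+s≤j)))
      where
      R : Fin k → ℕ → Set
      R x i = ∃[ Q ] (lo ≤ Q × Q ≤ hi × Lift Q x × colour x ≡ γ × i ≡ block n t Q)
      same-position : ∀ {Q Q′ x y} → Lift Q x → Lift Q′ y → colour x ≡ γ → colour y ≡ γ →
        position n t Q ≡ position n t Q′
      same-position Qx Q′y x≡γ y≡γ =
        trans (sym (toℕ-colour Qx)) (trans (cong toℕ (trans x≡γ (sym y≡γ))) (toℕ-colour Q′y))
      total : ∀ {x} → x ∈ colourClass H colour γ ∩ vertexSet w → ∃[ i ] R x i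
      total x∈ with x∈γ , x∈w ← x∈p∩q⁻ (colourClass H colour γ) (vertexSet w) x∈
        with Q , lo≤Q , Q≤hi , Qx ← lifts (∈fromList⁻ (vertices w) x∈w)
        = block n t Q , Q , lo≤Q , Q≤hi , Qx , ∈colourClass⁻ H colour x∈γ , refl

  -- Cutting the cycle at an unoccupied point p₀ leaves a linear order, coloured periodically.
  hole-colourable : ∀ p₀ → p₀ < n → ¬ Occupied p₀ → ∀ s d c μ .{{_ : NonZero c}} → μ ≤ c * s →
    (∀ {u v P} (w : Walk H u v) → length w ≤ d → (W : Window w P) → Window.hi W < Window.lo W + μ) →
    Colourable H (suc s) d c
  hole-colourable p₀ p₀<n hole s d c μ μ≤cs short = colour , λ γ w _ w≤d → s≤s (few γ w w≤d)
    where
    -- Adding `e` rotates the hole to 0, so that `pos` counts from the hole.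
    e = n ∸ p₀
    p₀+e≡n : p₀ + e ≡ n
    p₀+e≡n = m+[n∸m]≡n (<⇒≤ p₀<n)

    pos : Fin k → ℕ
    pos x = (toℕ (to x) + e) % n

    colour : Fin k → Fin c
    -- With `t = 1` the position is the residue modulo `c`, and the blocks consist of `c`
    -- consecutive numbers.
    colour x = fromℕ< (position< c 1 {c} (pos x) (≤-reflexive (sym (*-identityʳ c))))

    same-position : ∀ {x y γ} → colour x ≡ γ → colour y ≡ γ → position c 1 (pos x) ≡ position c 1 (pos y)
    same-position x≡γ y≡γ = trans (sym (toℕ-fromℕ< _)) (trans (cong toℕ (trans x≡γ (sym y≡γ))) (toℕ-fromℕ< _))

    -- A window contains no hole, so `Q + e` passes no multiple of `n` in it: along the window,
    -- `pos` is `Q` up to a constant.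
    level : ∀ {u v P} (w : Walk H u v) (W : Window w P) → let open Window W in
      ∀ {Q x} → lo ≤ Q → Q ≤ hi → Lift Q x → Q + e ≡ pos x + (lo + e) /ℕ n * n
    level w W {Q} {x} lo≤Q Q≤hi Qx = begin-equality
      Q + e                               ≡⟨ m≡m%n+[m/n]*n (Q + e) n ⟩
      (Q + e) % n + (Q + e) /ℕ n * n       ≡⟨ cong₂ (λ r q → r + q * n) (sym (trans (cong (λ z → (z + e) % n) (sym Qx)) (%-+ˡ Q e n))) same ⟩
      pos x + J * n                       ∎
      where
      open ≤-Reasoning
      open Window W
      J = (lo + e) /ℕ n
      same : (Q + e) /ℕ n ≡ J
      same with <-cmp ((Q + e) /ℕ n) J
      ... | tri≈ _ eq _ = eq
      ... | tri< lt _ _ = contradiction (/-monoˡ-≤ n (+-monoˡ-≤ e lo≤Q)) (<⇒≱ lt)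
      ... | tri> _ _ J<  = contradiction (occupied-cong R≡p₀ (filled R lo≤R R≤Q)) hole
        where
        -- The lift of the hole at which the next turn would begin.
        R = suc J * n ∸ e
        R+e : R + e ≡ suc J * n
        R+e = m∸n+n≡m (≤-trans (m∸n≤m n p₀) (m≤m+n n (J * n)))
        lo≤R : lo ≤ R
        lo≤R = +-cancelʳ-≤ e lo R (≤-trans (<⇒≤ (begin-strict
          lo + e                    ≡⟨ m≡m%n+[m/n]*n (lo + e) n ⟩
          (lo + e) % n + J * n      <⟨ +-monoˡ-< (J * n) (m%n<n (lo + e) n) ⟩
          suc J * n                 ∎)) (≤-reflexive (sym R+e)))
        R≤Q : R ≤ hi
        R≤Q = ≤-trans (+-cancelʳ-≤ e R Q (≤-trans (≤-reflexive R+e)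
          (≤-trans (*-monoˡ-≤ n J<) (m/n*n≤m (Q + e) n)))) Q≤hi
        R≡p₀ : R % n ≡ p₀ % n
        R≡p₀ = trans (sym ([m+n]%n≡m%n R n)) (trans (cong (_% n) (begin-equality
          R + n             ≡⟨ cong (R +_) (trans (sym p₀+e≡n) (+-comm p₀ e)) ⟩
          R + (e + p₀)      ≡⟨ +-assoc R e p₀ ⟨
          R + e + p₀        ≡⟨ cong (_+ p₀) R+e ⟩
          suc J * n + p₀    ≡⟨ +-comm (suc J * n) p₀ ⟩
          p₀ + suc J * n    ∎)) ([m+kn]%n≡m%n p₀ (suc J) n))

    few : ∀ γ {u v} (w : Walk H u v) → length w ≤ d → ∣ colourClass H colour γ ∩ vertexSet w ∣ ≤ s
    few γ {u} w w≤d = spread⇒∣p∣≤ s _ R total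
        (λ (Q , lo≤Q , Q≤hi , Qx , x≡γ , i≡) (Q′ , lo≤Q′ , Q′≤hi , Q′y , y≡γ , i≡′) → lift-injective Qx
          (subst (λ z → Lift z _) (+-cancelʳ-≡ e Q′ Q (trans (level w W lo≤Q′ Q′≤hi Q′y)
            (trans (cong (_+ (lo + e) /ℕ n * n) (sym (position-block-injective c 1
              (same-position x≡γ y≡γ) (trans (sym i≡) i≡′)))) (sym (level w W lo≤Q Q≤hi Qx))))) Q′y))
        (λ {x} {y} (Q , lo≤Q , Q≤hi , Qx , x≡γ , i≡) (Q′ , lo≤Q′ , Q′≤hi , Q′y , y≡γ , i≡′) → ≰⇒> λ i+s≤j →
          <⇒≱ (≤-<-trans Q′≤hi (≤-trans (short w w≤d W) (+-monoˡ-≤ μ lo≤Q)))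
            (+-cancelʳ-≤ e (Q + μ) Q′ (begin
              Q + μ + e                               ≡⟨ trans (+-assoc Q μ e) (trans (cong (Q +_) (+-comm μ e)) (sym (+-assoc Q e μ))) ⟩
              Q + e + μ                               ≡⟨ cong (_+ μ) (level w W lo≤Q Q≤hi Qx) ⟩
              pos x + (lo + e) /ℕ n * n + μ            ≡⟨ trans (+-assoc (pos x) _ μ) (trans (cong (pos x +_) (+-comm _ μ)) (sym (+-assoc (pos x) μ _))) ⟩
              pos x + μ + (lo + e) /ℕ n * n            ≤⟨ +-monoˡ-≤ ((lo + e) /ℕ n * n) (position-block-spread c 1 {pos x} {pos y} (≤-trans (≤-reflexive (*-identityˡ μ)) μ≤cs)
                                                          (same-position x≡γ y≡γ) (subst₂ (λ a b → a + s ≤ b) i≡ i≡′ i+s≤j)) ⟩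
              pos y + (lo + e) /ℕ n * n                ≡⟨ level w W lo≤Q′ Q′≤hi Q′y ⟨
              Q′ + e                                  ∎)))
      where
      open ≤-Reasoning
      W : Window w (toℕ (to u) + length w * n)
      W = startWindow w (toℕ (to u)) (lift-toℕ u)
      open Window W
      R : Fin k → ℕ → Set
      R x i = ∃[ Q ] (lo ≤ Q × Q ≤ hi × Lift Q x × colour x ≡ γ × i ≡ block c 1 (pos x))
      total : ∀ {x} → x ∈ colourClass H colour γ ∩ vertexSet w → ∃[ i ] R x i
      total {x} x∈ with x∈γ , x∈w ← x∈p∩q⁻ (colourClass H colour γ) (vertexSet w) x∈
        with Q , lo≤Q , Q≤hi , Qx ← lifts (∈fromList⁻ (vertices w) x∈w)
        = block c 1 (pos x) , Q , lo≤Q , Q≤hi , Qx , ∈colourClass⁻ H colour x∈γ , refl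

-- Auxiliary facts on ceilings, lists and halves

ceiling-div : ∀ m s .{{_ : NonZero s}} → 1 ≤ m → ∃[ c ] (c * s < m × m ≤ suc c * s)
-- Dividing the predecessor makes exact multiples of `s` come out right: the ceiling is the
-- successor of this quotient.
ceiling-div (suc m) s _ = m /ℕ s , s≤s (m/n*n≤m m s) ,
  ≤-trans (s≤s (≤-reflexive (m≡m%n+[m/n]*n m s))) (+-monoˡ-≤ (m /ℕ s * s) (m%n<n m s))

applyUpTo-cong : ∀ {A : Set} {x y : ℕ → A} → (∀ i → x i ≡ y i) → ∀ ℓ → applyUpTo x ℓ ≡ applyUpTo y ℓ
applyUpTo-cong x≡y zero    = refl
applyUpTo-cong x≡y (suc ℓ) = cong₂ _∷_ (x≡y 0) (applyUpTo-cong (x≡y ∘ suc) ℓ)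

applyUpTo-+ : ∀ {A : Set} (x : ℕ → A) i j → applyUpTo x (i + j) ≡ applyUpTo x i ++ applyUpTo (λ l → x (i + l)) j
applyUpTo-+ x zero    j = refl
applyUpTo-+ x (suc i) j = cong (x 0 ∷_) (applyUpTo-+ (x ∘ suc) i j)

m+m≤n⇒m≤⌊n/2⌋ : ∀ {m n} → m + m ≤ n → m ≤ ⌊ n /2⌋
m+m≤n⇒m≤⌊n/2⌋ {m} m+m≤n = ≤-trans (≤-reflexive (n≡⌊n+n/2⌋ m)) (⌊n/2⌋-mono m+m≤n)

⌊n/2⌋+⌊n/2⌋≤n : ∀ n → ⌊ n /2⌋ + ⌊ n /2⌋ ≤ n
⌊n/2⌋+⌊n/2⌋≤n n = ≤-trans (+-monoʳ-≤ ⌊ n /2⌋ (⌊n/2⌋≤⌈n/2⌉ n)) (≤-reflexive (⌊n/2⌋+⌈n/2⌉≡n n))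

HasPerfectNumbers : ∀ {n} → Graph n → (s d : ℕ) → .{{NonZero s}} → Set
HasPerfectNumbers G s d =
  ∃[ χ ] ∃[ ω ] (IsChromaticNumber G (suc s) d χ × IsCliqueNumber G (suc s) d ω × ℤ.+ χ ≡ ⌈ (ℤ.+ ω) / s ⌉)

-- Proper induced subgraphs: cycles with a hole

module Hole {n k : ℕ} (3≤n : 3 ≤ n) .{{_ : NonZero n}} .{{_ : NonZero k}} (f : Fin k ↣ Fin n) where
  open Injection f using (to)
  open InducedCycle 3≤n f
  open Arcs 3≤n f
  open Colourings 3≤n f

  Run : ℕ → Set
  Run j = ∃[ a ] (∀ {i} → i < j → Occupied (toℕ {n} a + i))

  run? : ∀ j → Dec (Run j)
  run? j = any? λ a → allUpTo? (λ i → occupied? (toℕ a + i)) j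

  run-1 : Run 1
  run-1 = to v₀ , λ { (s≤s z≤n) → subst Occupied (sym (+-identityʳ _)) (v₀ , lift-toℕ v₀) }
    where
    v₀ : Fin k
    v₀ = fromℕ< (>-nonZero⁻¹ k)

  -- The longest run of at most `d + 1` consecutive vertices decides both invariants: as an arc it
  -- is a clique, and since no walk of length at most `d` has a wider window, the periodic colouring
  -- matches it.
  hole⇒perfect : ∀ s d .{{_ : NonZero s}} p₀ → p₀ < n → ¬ Occupied p₀ → HasPerfectNumbers H s d
  hole⇒perfect s d p₀ p₀<n hole with greatest Run run? (suc d) 1 (s≤s z≤n) run-1
  ... | zero  , _ , _ , max = contradiction (max 1 (s≤s z≤n) run-1) λ ()
  ... | suc ℓ , (a , run) , s≤s ℓ≤d , max
    with c , cs<μ , μ≤1+cs ← ceiling-div (suc ℓ) s (s≤s z≤n)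
    = colouring∧clique⇒χ≡⌈ω/s⌉ H (arcSet (toℕ a) ℓ)
        (hole-colourable p₀ p₀<n hole s d (suc c) (suc ℓ) μ≤1+cs narrow)
        (arcSet-clique occ ℓ<n geo (suc s) ℓ≤d)
        (≤-trans cs<μ (∣arcSet∣ occ ℓ<n geo))
    where
    occ : OccupiedArc (toℕ a) ℓ
    occ i i≤ℓ = run (s≤s i≤ℓ)
    ℓ<n : ℓ < n
    -- Otherwise the run would go all the way round and meet the hole.
    ℓ<n = ≰⇒> λ n≤ℓ →
      let R , a≤R , R<a+n , R≡p₀ = residueFrom n (toℕ a) p₀ p₀<n
          i<n : R ∸ toℕ a < n
          i<n = +-cancelˡ-< (toℕ a) _ n (subst (_< toℕ a + n) (sym (m+[n∸m]≡n a≤R)) R<a+n)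
      in hole (occupied-cong {R} (trans R≡p₀ (sym (m<n⇒m%n≡m p₀<n)))
           (subst Occupied (m+[n∸m]≡n a≤R) (occ (R ∸ toℕ a) (≤-trans (<⇒≤ i<n) n≤ℓ))))
    geo : Geodesic (toℕ a) ℓ
    geo = hole-geodesic p₀ p₀<n hole (toℕ a) ℓ ℓ<n occ
    narrow : ∀ {u v P} (w : Walk H u v) → length w ≤ d → (W : Window w P) → Window.hi W < Window.lo W + suc ℓ
    -- A wider window would contain a run of `suc (suc ℓ)` vertices, still at most `d + 1`, against
    -- maximality.
    narrow w w≤d W = ≰⇒> λ lo+μ≤hi → <-irrefl refl (max (suc (suc ℓ))
      (s≤s (≤-trans (+-cancelˡ-≤ lo _ _ (≤-trans lo+μ≤hi (Window.narrow W))) w≤d))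
      (fromℕ< (m%n<n lo n) , λ {i} i≤1+ℓ →
        occupied-cong {lo + i} (trans (sym (%-+ˡ lo i n)) (cong (λ z → (z + i) % n) (sym (toℕ-fromℕ< (m%n<n lo n)))))
          (Window.filled W (lo + i) (m≤m+n lo i) (≤-trans (+-monoʳ-≤ lo (≤-pred i≤1+ℓ)) lo+μ≤hi))))
      where lo = Window.lo W

-- The full cycle: distances, colourings and density

module Full {n k : ℕ} (3≤n : 3 ≤ n) .{{_ : NonZero n}} .{{_ : NonZero k}} (f : Fin k ↣ Fin n)
            (full : ∀ P → InducedCycle.Occupied 3≤n f P) where
  open Injection f using (to)
  open InducedCycle 3≤n f
  open Arcs 3≤n f
  open Colourings 3≤n f

  arcOccupied : ∀ a ℓ → OccupiedArc a ℓ
  arcOccupied a ℓ i _ = full (a + i)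

  half<n : ∀ {ℓ} → ℓ + ℓ ≤ n → ℓ < n
  half<n {zero}  _ = ≤-trans (s≤s z≤n) 3≤n
  half<n {suc ℓ} 2ℓ≤n = ≤-trans (m<m+n (suc ℓ) (s≤s z≤n)) 2ℓ≤n

  ShortPath : Fin k → Fin k → Set
  ShortPath u v = Σ[ w ∈ Walk H u v ] (IsPath w × length w + length w ≤ n)

  -- Go forward if that takes at most half a turn, otherwise backward along the complementary arc.
  shortPath : ∀ u v → ShortPath u v
  shortPath u v with R , P≤R , R<P+n , Rv ← residueFrom n (toℕ (to u)) (toℕ (to v)) (toℕ<n (to v))
    with (R ∸ toℕ (to u)) + (R ∸ toℕ (to u)) ≤? n
  ... | yes 2ℓ≤n = subst₂ ShortPath
      (lift-injective {P + 0} (pick-lift (full (P + 0))) (subst (λ z → Lift z u) (sym (+-identityʳ P)) (lift-toℕ u)))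
      (lift-injective {P + ℓ} (pick-lift (full (P + ℓ))) (subst (λ z → Lift z v) (sym (m+[n∸m]≡n P≤R)) Rv))
      (arc occ ℓ<n , arc-isPath occ ℓ<n , subst (λ z → z + z ≤ n) (sym (length-arc occ ℓ<n)) 2ℓ≤n)
    where
    P = toℕ (to u)
    ℓ = R ∸ P
    occ = arcOccupied P ℓ
    ℓ<n : ℓ < n
    ℓ<n = half<n 2ℓ≤n
  ... | no 2ℓ≰n = subst₂ ShortPath
      (lift-injective {R + r} (pick-lift (full (R + r))) (subst (λ z → Lift z u) (sym R+r≡P+n)
        (trans ([m+n]%n≡m%n P n) (lift-toℕ u))))
      (lift-injective {R + (r ∸ r)} (pick-lift (full (R + (r ∸ r))))
        (subst (λ z → Lift z v) (sym (trans (cong (R +_) (n∸n≡0 r)) (+-identityʳ R))) Rv))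
      (reverseArc occ r<n , reverseArc-isPath occ r<n ,
        subst (λ z → z + z ≤ n) (sym (length-reverseArc occ r<n)) 2r≤n)
    where
    P = toℕ (to u)
    ℓ = R ∸ P
    r = P + n ∸ R
    R+r≡P+n : R + r ≡ P + n
    R+r≡P+n = m+[n∸m]≡n (<⇒≤ R<P+n)
    ℓ+r≡n : ℓ + r ≡ n
    ℓ+r≡n = +-cancelˡ-≡ P _ _ (trans (sym (+-assoc P ℓ r)) (trans (cong (_+ r) (m+[n∸m]≡n P≤R)) R+r≡P+n))
    2r≤n : r + r ≤ n
    2r≤n = ≤-trans (+-monoˡ-≤ r (<⇒≤ (≰⇒> λ ℓ≤r → 2ℓ≰n (≤-trans (+-monoʳ-≤ ℓ ℓ≤r) (≤-reflexive ℓ+r≡n)))))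
      (≤-reflexive ℓ+r≡n)
    occ = arcOccupied R r
    r<n : r < n
    r<n = half<n 2r≤n

  distance≤half : ∀ {u v ℓ} → IsDistance H u v ℓ → ℓ ≤ ⌊ n /2⌋
  distance≤half {u} {v} (_ , min) with w , path , 2w≤n ← shortPath u v =
    ≤-trans (min w path) (m+m≤n⇒m≤⌊n/2⌋ 2w≤n)

  geodesic : ∀ a {ℓ} → ℓ ≤ ⌊ n /2⌋ → Geodesic a ℓ
  geodesic a {ℓ} ℓ≤h = half-geodesic a ℓ (half<n 2ℓ≤n) 2ℓ≤n
    where
    2ℓ≤n : ℓ + ℓ ≤ n
    2ℓ≤n = ≤-trans (+-mono-≤ ℓ≤h ℓ≤h) (⌊n/2⌋+⌊n/2⌋≤n n)

  ≤half⇒<n : ∀ {ℓ} → ℓ ≤ ⌊ n /2⌋ → ℓ < n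
  ≤half⇒<n ℓ≤h = half<n (≤-trans (+-mono-≤ ℓ≤h ℓ≤h) (⌊n/2⌋+⌊n/2⌋≤n n))

  diameter≡half : ∀ {D} → IsDiameter H D → D ≡ ⌊ n /2⌋
  diameter≡half ((_ , _ , dist) , bound) = ≤-antisym (distance≤half dist)
    (let h = ⌊ n /2⌋
         ℓ , ((w , _ , w≡ℓ) , _) , ℓ≤D = bound (pick 0) (pick h)
     in ≤-trans (geodesic 0 ≤-refl w (pick-lift (full 0)) (pick-lift (full h))) (≤-trans (≤-reflexive w≡ℓ) ℓ≤D))

  -- `D` is to be the minimum of `d` and the diameter; its maximality is a separate hypothesis of
  -- `full⇒perfect`.
  module _ {s d D : ℕ} .{{_ : NonZero s}} (D≤d : D ≤ d) (D≤h : D ≤ ⌊ n /2⌋) where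

    full⇒perfect : (∀ {ℓ} → ℓ ≤ d → ℓ ≤ ⌊ n /2⌋ → ℓ ≤ D) → ∀ c t → c * s < suc D →
      t * suc D ≤ n * s → n ≤ suc c * t → HasPerfectNumbers H s d
    -- `t = 0` would force `n = 0`.
    full⇒perfect D-max c zero cs<m tm≤ns n≤ct =
      contradiction (≤-trans (≤-trans (s≤s z≤n) 3≤n) (≤-trans n≤ct (≤-reflexive (*-zeroʳ (suc c))))) λ ()
    full⇒perfect D-max c t@(suc _) cs<m tm≤ns n≤ct = colouring∧clique⇒χ≡⌈ω/s⌉ H (arcSet 0 D)
      (cycle-colourable s d t (suc c) (suc D) tm≤ns n≤ct
        λ w (_ , dist) w≤d → s≤s (D-max w≤d (distance≤half dist)))
      (arcSet-clique (arcOccupied 0 D) (≤half⇒<n D≤h) (geodesic 0 D≤h) (suc s) D≤d)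
      (≤-trans cs<m (∣arcSet∣ (arcOccupied 0 D) (≤half⇒<n D≤h) (geodesic 0 D≤h)))

    module _ (X : Subset k) (ind : Independent H (suc s) d X) where

      -- Counted along the unrolled cycle: a list, unlike a subset, keeps the multiplicity of
      -- vertices met on several turns.
      hits : ℕ → ℕ → List (Fin k)
      hits a ℓ = filter (_∈? X) (applyUpTo (λ i → pick (a + i)) ℓ)

      ∣hits-+∣ : ∀ a i j → List.length (hits a (i + j)) ≡ List.length (hits a i) + List.length (hits (a + i) j)
      ∣hits-+∣ a i j = trans (cong List.length (trans
          (cong (filter (_∈? X)) (trans (applyUpTo-+ (λ l → pick (a + l)) i j)
            (cong (applyUpTo (λ l → pick (a + l)) i ++_) (applyUpTo-cong (λ l → cong pick (sym (+-assoc a i l))) j))))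
          (filter-++ (_∈? X) (applyUpTo (λ l → pick (a + l)) i) (applyUpTo (λ l → pick (a + i + l)) j))))
        (length-++ (hits a i))

      ∣hits-window∣≤s : ∀ a → List.length (hits a (suc D)) ≤ s
      ∣hits-window∣≤s a = ≤-trans
        (length≤∣p∣ {p = X ∩ arcSet a D}
          (Unique.filter⁺ (_∈? X) (subst Unique (vertices-sequenceWalk H _ D _)
            (arc-isPath (arcOccupied a D) (≤half⇒<n D≤h))))
          λ x∈ → let x∈l , x∈X = ∈-filter⁻ (_∈? X) x∈ in x∈p∩q⁺ (x∈X , ∈fromList⁺ x∈l))
        (≤-pred (independent∩arcSet (arcOccupied a D) (≤half⇒<n D≤h) (geodesic a D≤h) {X = X} D≤d ind))

      ∣X∣≤∣hits-turn∣ : ∀ a → ∣ X ∣ ≤ List.length (hits a n)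
      ∣X∣≤∣hits-turn∣ a = ∣p∣≤length (hits a n) λ {x} x∈X →
        let R , a≤R , R<a+n , Rx = residueFrom n a (toℕ (to x)) (toℕ<n (to x))
            i<n : R ∸ a < n
            i<n = +-cancelˡ-< a _ n (subst (_< a + n) (sym (m+[n∸m]≡n a≤R)) R<a+n)
        in ∈-filter⁺ (_∈? X) (subst (_∈ˡ applyUpTo (λ i → pick (a + i)) n)
             (lift-injective {a + (R ∸ a)} (pick-lift (full _)) (subst (λ z → Lift z x) (sym (m+[n∸m]≡n a≤R)) Rx))
             (∈-applyUpTo⁺ (λ i → pick (a + i)) i<n)) x∈X

      ∣hits-windows∣ : ∀ j a → List.length (hits a (j * suc D)) ≤ j * s
      ∣hits-windows∣ zero    a = z≤n
      ∣hits-windows∣ (suc j) a = ≤-trans (≤-reflexive (∣hits-+∣ a (suc D) (j * suc D)))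
        (+-mono-≤ (∣hits-window∣≤s a) (∣hits-windows∣ j (a + suc D)))

      ∣hits-turns∣ : ∀ j a → j * ∣ X ∣ ≤ List.length (hits a (j * n))
      ∣hits-turns∣ zero    a = z≤n
      ∣hits-turns∣ (suc j) a = ≤-trans (+-mono-≤ (∣X∣≤∣hits-turn∣ a) (∣hits-turns∣ j (a + n)))
        (≤-reflexive (sym (∣hits-+∣ a n (j * n))))

      -- n consecutive windows of length D + 1 wind D + 1 times around the cycle.
      independent-density : suc D * ∣ X ∣ ≤ n * s
      independent-density = ≤-trans (∣hits-turns∣ (suc D) 0)
        (≤-trans (≤-reflexive (cong (λ z → List.length (hits 0 z)) (*-comm (suc D) n))) (∣hits-windows∣ n 0))

    -- The witness is the largest size that `independent-density` permits a colour class, and `c`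
    -- such classes have to cover all vertices.
    colourable⇒density : ∀ {c} → Colourable H (suc s) d c → ∃[ t ] (t * suc D ≤ n * s × k ≤ c * t)
    colourable⇒density {c} (colour , ind) = n * s /ℕ suc D , m/n*n≤m (n * s) (suc D) ,
      subst (_≤ c * (n * s /ℕ suc D)) (∣⊤∣≡n k) (covered⇒∣p∣≤ c (n * s /ℕ suc D) {⊤} (colourClass H colour)
        (λ {x} _ → colour x , ∈colourClass⁺ H colour refl)
        λ i → ≤-trans (≤-reflexive (sym (m*n/n≡m ∣ colourClass H colour i ∣ (suc D))))
          (/-monoˡ-≤ (suc D) (≤-trans (≤-reflexive (*-comm ∣ colourClass H colour i ∣ (suc D)))
            (independent-density (colourClass H colour i) (ind i)))))

-- Cliques of the full cycle

module CliqueBound {n k : ℕ} (3≤n : 3 ≤ n) .{{_ : NonZero n}} .{{_ : NonZero k}} (f : Fin k ↣ Fin n)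
            (full : ∀ P → InducedCycle.Occupied 3≤n f P) where
  open Injection f using (to)
  open InducedCycle 3≤n f
  open Arcs 3≤n f
  open Full 3≤n f full

  -- From here on `δ` is handled through `δ<n` and `lift-+δ`, which determine it by `δ-unique`.
  abstract

    turn : ∀ x y → ∃[ R ] (toℕ (to x) ≤ R × R < toℕ (to x) + n × R % n ≡ toℕ (to y))
    turn x y = residueFrom n (toℕ (to x)) (toℕ (to y)) (toℕ<n (to y))

    -- The number of steps from x forward to y.
    δ : Fin k → Fin k → ℕ
    δ x y = proj₁ (turn x y) ∸ toℕ (to x)

    x+δ : ∀ x y → toℕ (to x) + δ x y ≡ proj₁ (turn x y)
    x+δ x y = m+[n∸m]≡n (proj₁ (proj₂ (turn x y)))

    δ<n : ∀ x y → δ x y < n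
    δ<n x y = +-cancelˡ-< (toℕ (to x)) _ n
      (subst (_< toℕ (to x) + n) (sym (x+δ x y)) (proj₁ (proj₂ (proj₂ (turn x y)))))

    lift-+δ : ∀ {P x} y → Lift P x → Lift (P + δ x y) y
    lift-+δ {P} {x} y Px = trans (%-cong-+ (δ x y) n (trans Px (sym (lift-toℕ x))))
      (trans (cong (_% n) (x+δ x y)) (proj₂ (proj₂ (proj₂ (turn x y)))))

  δ-unique : ∀ {P i x y} → Lift P x → Lift (P + i) y → i < n → δ x y ≡ i
  δ-unique {P} {i} {x} {y} Px P+iy i<n with <-cmp (δ x y) i
  ... | tri≈ _ e _ = e
  ... | tri< lt _ _ = contradiction (trans (lift-+δ y Px) (sym P+iy))
    (%≢ n (+-monoʳ-< P lt) (≤-trans (+-monoʳ-< P i<n) (+-monoˡ-≤ n (m≤m+n P (δ x y)))))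
  ... | tri> _ _ gt = contradiction (trans P+iy (sym (lift-+δ y Px)))
    (%≢ n (+-monoʳ-< P gt) (≤-trans (+-monoʳ-< P (δ<n x y)) (+-monoˡ-≤ n (m≤m+n P i))))

  δ-refl : ∀ x → δ x x ≡ 0
  δ-refl x = δ-unique (lift-toℕ x) (subst (λ z → Lift z x) (sym (+-identityʳ _)) (lift-toℕ x)) (≤-trans (s≤s z≤n) 3≤n)

  δ-injective : ∀ {x y z} → δ x y ≡ δ x z → y ≡ z
  δ-injective {x} {y} {z} e = lift-injective {toℕ (to x) + δ x z}
    (subst (λ i → Lift (toℕ (to x) + i) y) e (lift-+δ y (lift-toℕ x))) (lift-+δ z (lift-toℕ x))

  -- If `y` is met no later than `z` on the way forward from `x`, the rest of that way leads from
  -- `y` to `z`.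
  δ-∸ : ∀ {x y z} → δ x y ≤ δ x z → δ y z ≡ δ x z ∸ δ x y
  δ-∸ {x} {y} {z} le = δ-unique (lift-+δ y (lift-toℕ x))
    (subst (λ P → Lift P z) (sym (trans (+-assoc (toℕ (to x)) (δ x y) _) (cong (toℕ (to x) +_) (m+[n∸m]≡n le))))
      (lift-+δ z (lift-toℕ x)))
    (≤-<-trans (m∸n≤m (δ x z) (δ x y)) (δ<n x z))

  δ-reverse : ∀ {x y} → x ≢ y → δ x y + δ y x ≡ n
  δ-reverse {x} {y} x≢y = trans (cong (δ x y +_) (δ-unique (lift-+δ y (lift-toℕ x))
      (subst (λ P → Lift P x) (sym (trans (+-assoc (toℕ (to x)) (δ x y) _)
          (cong (toℕ (to x) +_) (m+[n∸m]≡n (<⇒≤ (δ<n x y))))))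
        (trans ([m+n]%n≡m%n (toℕ (to x)) n) (lift-toℕ x)))
      (∸-monoʳ-< {n} {δ x y} {0} (n≢0⇒n>0 λ δ≡0 → x≢y (δ-injective (trans (δ-refl x) (sym δ≡0)))) (<⇒≤ (δ<n x y)))))
    (m+[n∸m]≡n (<⇒≤ (δ<n x y)))

  module _ {s d D : ℕ} (2≤s : 2 ≤ s) (D+D≤n : D + D ≤ n) (D-max : ∀ {ℓ} → ℓ ≤ d → ℓ ≤ ⌊ n /2⌋ → ℓ ≤ D)
           {S : Subset k} (clique : Clique H (suc s) d S) where

    infix 4 _⇒_
    _⇒_ : Fin k → Fin k → Set
    x ⇒ y = δ x y ≤ D

    ⇒-refl : ∀ x → x ⇒ x
    ⇒-refl x = ≤-trans (≤-reflexive (δ-refl x)) z≤n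

    -- The two ways round add up to `n`, which is at least `D + D`; if neither exceeds `D`, both
    -- equal `D` and the vertices are antipodal.
    ⇒-antisym : ∀ {x y} → x ≢ y → x ⇒ y → y ⇒ x → δ x y ≡ D
    ⇒-antisym {x} {y} x≢y xy yx = ≤-antisym xy (+-cancelʳ-≤ (δ y x) D (δ x y)
      (≤-trans (+-monoʳ-≤ D yx) (≤-trans D+D≤n (≤-reflexive (sym (δ-reverse x≢y))))))

    Triple : Fin k → Fin k → Fin k → Set
    Triple x y z = (x ⇒ y × x ⇒ z) ⊎ (y ⇒ x × y ⇒ z) ⊎ (z ⇒ x × z ⇒ y)

    -- The three lifts in the window of the walk are ordered as numbers; the smallest belongs to the
    -- vertex that has the other two ahead of it.
    cover⇒triple : ∀ {u v} (w : Walk H u v) → length w ≤ D → ∀ {x y z} →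
      x ∈ vertexSet w → y ∈ vertexSet w → z ∈ vertexSet w → Triple x y z
    cover⇒triple {u} w w≤D {x} {y} {z} x∈ y∈ z∈
      with record { lo = lo ; hi = hi ; narrow = narrow ; lifts = lifts } ← startWindow w (toℕ (to u)) (lift-toℕ u)
      with X , lo≤X , X≤hi , Xx ← lifts (∈fromList⁻ (vertices w) x∈)
         | Y , lo≤Y , Y≤hi , Yy ← lifts (∈fromList⁻ (vertices w) y∈)
         | Z , lo≤Z , Z≤hi , Zz ← lifts (∈fromList⁻ (vertices w) z∈)
      = first (≤-total X Y) (≤-total Y Z) (≤-total X Z)
      where
      step : ∀ {A B a b} → Lift A a → Lift B b → lo ≤ A → B ≤ hi → A ≤ B → a ⇒ b
      step {A} {B} {a} {b} Aa Bb lo≤A B≤hi A≤B = subst (_≤ D) (sym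
        (δ-unique Aa (subst (λ P → Lift P b) (sym (m+[n∸m]≡n A≤B)) Bb) (≤-<-trans i≤D (half<n D+D≤n)))) i≤D
        where
        i≤D : B ∸ A ≤ D
        i≤D = ≤-trans (∸-mono (≤-trans B≤hi narrow) lo≤A) (≤-trans (≤-reflexive (m+n∸m≡n lo (length w))) w≤D)
      first : X ≤ Y ⊎ Y ≤ X → Y ≤ Z ⊎ Z ≤ Y → X ≤ Z ⊎ Z ≤ X → Triple x y z
      first (inj₁ X≤Y) _ (inj₁ X≤Z) = inj₁ (step Xx Yy lo≤X Y≤hi X≤Y , step Xx Zz lo≤X Z≤hi X≤Z)
      first (inj₁ X≤Y) _ (inj₂ Z≤X) = inj₂ (inj₂ (step Zz Xx lo≤Z X≤hi Z≤X , step Zz Yy lo≤Z Y≤hi (≤-trans Z≤X X≤Y)))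
      first (inj₂ Y≤X) (inj₁ Y≤Z) _ = inj₂ (inj₁ (step Yy Xx lo≤Y X≤hi Y≤X , step Yy Zz lo≤Y Z≤hi Y≤Z))
      first (inj₂ Y≤X) (inj₂ Z≤Y) _ = inj₂ (inj₂ (step Zz Xx lo≤Z X≤hi (≤-trans Z≤Y Y≤X) , step Zz Yy lo≤Z Y≤hi Z≤Y))

    module _ (s<S : s < ∣ S ∣) where

      -- Because `2 ≤ s`, three vertices can be enlarged within `S` to a set of `suc s` vertices,
      -- which a single short shortest path covers.
      triple : ∀ {x y z} → x ∈ S → y ∈ S → z ∈ S → Triple x y z
      triple {x} {y} {z} x∈S y∈S z∈S =
        let l = x ∷ y ∷ z ∷ []
            T , l⊆T , T⊆S , T≡k = interpolate (suc s) (fromList l) S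
              (λ u∈l → member (∈fromList⁻ l u∈l)) (≤-trans (∣fromList∣≤length l) (s≤s 2≤s)) s<S
            u , v , w , (_ , dist) , w≤d , T⊆w = clique T T⊆S T≡k
        in cover⇒triple w (D-max w≤d (distance≤half dist)) (T⊆w (l⊆T (∈fromList⁺ {l = l} (here refl))))
             (T⊆w (l⊆T (∈fromList⁺ {l = l} (there (here refl))))) (T⊆w (l⊆T (∈fromList⁺ {l = l} (there (there (here refl))))))
        where
        member : ∀ {u} → u ∈ˡ x ∷ y ∷ z ∷ [] → u ∈ S
        member (here refl)                 = x∈S
        member (there (here refl))         = y∈S
        member (there (there (here refl))) = z∈S

      -- `S` then lies on the arc of `suc D` positions that begins at `r`.
      source⇒∣S∣≤ : ∀ r → (∀ {y} → y ∈ S → r ⇒ y) → ∣ S ∣ ≤ suc D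
      source⇒∣S∣≤ r r⇒ = ≤-trans
        (p⊆q⇒∣p∣≤∣q∣ λ {y} y∈S → ∈arcSet⁺ (toℕ (to r)) D (δ r y) (arcOccupied _ D) (r⇒ y∈S) (lift-+δ y (lift-toℕ r)))
        (≤-trans (∣fromList∣≤length (arcVertices (toℕ (to r)) D)) (≤-reflexive (length-applyUpTo (λ i → pick (toℕ (to r) + i)) (suc D))))

      Source : List (Fin k) → Set
      Source l = ∃[ r ] (r ∈ S × (∀ {y} → y ∈ˡ l → r ⇒ y))

      -- Without antipodal pairs the relation ⇒ is a transitive tournament on S.
      module _ (antisym : ∀ {x y} → x ∈ S → y ∈ S → x ⇒ y → y ⇒ x → x ≡ y) where

        -- Neither `r` nor `y` can be the source of the triple: the first gives `r ⇒ z` at once, and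
        -- the second gives it after antisymmetry identifies `y` with `r`.
        ⇒-through : ∀ {r y z} → r ∈ S → y ∈ S → r ⇒ y → ¬ (r ⇒ z) → Triple r y z → z ⇒ y
        ⇒-through _ _ _ ¬r⇒z (inj₁ (_ , r⇒z)) = contradiction r⇒z ¬r⇒z
        ⇒-through _ _ _ _ (inj₂ (inj₂ (_ , z⇒y))) = z⇒y
        ⇒-through {z = z} r∈S y∈S r⇒y ¬r⇒z (inj₂ (inj₁ (y⇒r , y⇒z))) =
          contradiction (subst (_⇒ z) (antisym y∈S r∈S y⇒r r⇒y) y⇒z) ¬r⇒z

        -- If the old source does not reach `z`, then by `⇒-through` the vertex `z` reaches
        -- everything in `l`.
        extendSource : ∀ z l → z ∈ S → (∀ {y} → y ∈ˡ l → y ∈ S) → Source l → Source (z ∷ l)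
        extendSource z l z∈S l⊆S (r , r∈S , r⇒) = decide (δ r z ≤? D)
          where
          decide : Dec (r ⇒ z) → Source (z ∷ l)
          decide (yes r⇒z) = r , r∈S , λ { (here refl) → r⇒z ; (there y∈l) → r⇒ y∈l }
          decide (no ¬r⇒z) = z , z∈S , λ
            { (here refl) → ⇒-refl z
            ; (there y∈l) → ⇒-through r∈S (l⊆S y∈l) (r⇒ y∈l) ¬r⇒z (triple r∈S (l⊆S y∈l) z∈S) }

        sourceOf : ∀ r → r ∈ S → ∀ l → (∀ {y} → y ∈ˡ l → y ∈ S) → Source l
        sourceOf r r∈S []      l⊆S = r , r∈S , λ ()
        sourceOf r r∈S (z ∷ l) l⊆S = extendSource z l (l⊆S (here refl)) (l⊆S ∘ there) (sourceOf r r∈S l (l⊆S ∘ there))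

      module _ {x y} (x∈S : x ∈ S) (y∈S : y ∈ S) (x≢y : x ≢ y) (x⇒y : x ⇒ y) (y⇒x : y ⇒ x) where

        δxy≡D : δ x y ≡ D
        δxy≡D = ⇒-antisym x≢y x⇒y y⇒x

        δyx≡D : δ y x ≡ D
        δyx≡D = ⇒-antisym (x≢y ∘ sym) y⇒x x⇒y

        -- Going forward from `x`, the vertex `z` comes after `y`, and from `y` only `D` steps are
        -- left to complete the turn.
        ¬x⇒z⇒y⇒z : ∀ {z} → ¬ (x ⇒ z) → y ⇒ z
        ¬x⇒z⇒y⇒z {z} ¬x⇒z = ≤-trans
          (≤-reflexive (trans (δ-∸ (≤-trans x⇒y (<⇒≤ (≰⇒> ¬x⇒z)))) (cong (δ x z ∸_) δxy≡D)))
          (≤-trans (∸-monoˡ-≤ D (<⇒≤ (δ<n x z))) (≤-reflexive (trans (cong (_∸ D)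
            (trans (sym (δ-reverse x≢y)) (cong₂ _+_ δxy≡D δyx≡D))) (m+n∸m≡n D D))))

        -- In the triple of `x`, `a`, `z` the source must be `z`: `x` does not reach `z`, and
        -- `a ⇒ x` would make `a` the antipode of `x`, which is `y`. In the triple of `y`, `z`, `a`
        -- it must be `a`, by a similar exclusion. So `a` and `z` are ahead of each other.
        opposite : ∀ {a z} → a ∈ S → z ∈ S → a ≢ x → a ≢ y → x ⇒ a → ¬ (x ⇒ z) → δ a z ≡ D × δ z a ≡ D
        opposite {a} {z} a∈S z∈S a≢x a≢y x⇒a ¬x⇒z = ⇒-antisym a≢z a⇒z z⇒a , ⇒-antisym (a≢z ∘ sym) z⇒a a⇒z
          where
          a≢z : a ≢ z
          a≢z refl = ¬x⇒z x⇒a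
          a⇒y : a ⇒ y
          a⇒y = ≤-trans (≤-reflexive (δ-∸ (≤-trans x⇒a (≤-reflexive (sym δxy≡D)))))
            (≤-trans (m∸n≤m (δ x y) (δ x a)) x⇒y)
          first-z : Triple x a z → z ⇒ a
          first-z (inj₁ (_ , x⇒z))        = contradiction x⇒z ¬x⇒z
          first-z (inj₂ (inj₂ (_ , z⇒a))) = z⇒a
          first-z (inj₂ (inj₁ (a⇒x , _))) =
            contradiction (δ-injective (trans (⇒-antisym (a≢x ∘ sym) x⇒a a⇒x) (sym δxy≡D))) a≢y
          first-a : Triple y z a → a ⇒ z
          first-a (inj₂ (inj₂ (_ , a⇒z))) = a⇒z
          first-a (inj₁ (_ , y⇒a)) =
            contradiction (δ-injective (trans (⇒-antisym (a≢y ∘ sym) y⇒a a⇒y) (sym δyx≡D))) a≢x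
          first-a (inj₂ (inj₁ (z⇒y , _))) = contradiction (subst (x ⇒_)
            (sym (δ-injective (trans (⇒-antisym (λ { refl → ¬x⇒z x⇒y }) (¬x⇒z⇒y⇒z ¬x⇒z) z⇒y) (sym δyx≡D))))
            (⇒-refl x)) ¬x⇒z
          z⇒a : z ⇒ a
          z⇒a = first-z (triple x∈S a∈S z∈S)
          a⇒z : a ⇒ z
          a⇒z = first-a (triple y∈S z∈S a∈S)

        -- The parts of `S` in the two open halves into which `x` and `y` divide the cycle.
        Ahead Behind : Fin k → Set
        Ahead a  = a ∈ S × a ≢ x × a ≢ y × x ⇒ a
        Behind z = z ∈ S × ¬ (x ⇒ z)

        location : ∀ {w} → w ∈ S → w ≡ x ⊎ w ≡ y ⊎ Ahead w ⊎ Behind w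
        location {w} w∈S = decide (w ≟ᶠ x) (w ≟ᶠ y) (δ x w ≤? D)
          where
          decide : Dec (w ≡ x) → Dec (w ≡ y) → Dec (x ⇒ w) → w ≡ x ⊎ w ≡ y ⊎ Ahead w ⊎ Behind w
          decide (yes w≡x) _         _          = inj₁ w≡x
          decide (no _)    (yes w≡y) _          = inj₂ (inj₁ w≡y)
          decide (no w≢x)  (no w≢y)  (yes x⇒w)  = inj₂ (inj₂ (inj₁ (w∈S , w≢x , w≢y , x⇒w)))
          decide (no _)    (no _)    (no ¬x⇒w)  = inj₂ (inj₂ (inj₂ (w∈S , ¬x⇒w)))

        -- If one open half contains no vertex of `S`, then `x` or `y` is a source. Otherwise each
        -- vertex in one half is antipodal to all those in the other, so each half holds exactly
        -- one.
        antipodal⇒∣S∣≤ : ∣ S ∣ ≤ suc D ⊎ ∣ S ∣ ≤ 4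
        antipodal⇒∣S∣≤ = decide
          (any? λ a → (a ∈? S) ×-dec (¬? (a ≟ᶠ x) ×-dec (¬? (a ≟ᶠ y) ×-dec (δ x a ≤? D))))
          (any? λ z → (z ∈? S) ×-dec ¬? (δ x z ≤? D))
          where
          decide : Dec (∃[ a ] Ahead a) → Dec (∃[ z ] Behind z) → ∣ S ∣ ≤ suc D ⊎ ∣ S ∣ ≤ 4
          decide _ (no ∄z) = inj₁ (source⇒∣S∣≤ x λ {w} w∈S →
            decidable-stable (δ x w ≤? D) λ ¬x⇒w → ∄z (w , w∈S , ¬x⇒w))
          decide (no ∄a) (yes _) = inj₁ (source⇒∣S∣≤ y λ w∈S → y⇒ (location w∈S))
            where
            y⇒ : ∀ {w} → w ≡ x ⊎ w ≡ y ⊎ Ahead w ⊎ Behind w → y ⇒ w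
            y⇒ (inj₁ refl)                     = y⇒x
            y⇒ (inj₂ (inj₁ refl))              = ⇒-refl y
            y⇒ (inj₂ (inj₂ (inj₁ ahead)))      = contradiction (_ , ahead) ∄a
            y⇒ (inj₂ (inj₂ (inj₂ (_ , ¬x⇒w)))) = ¬x⇒z⇒y⇒z ¬x⇒w
          decide (yes (a , a∈S , a≢x , a≢y , x⇒a)) (yes (z , z∈S , ¬x⇒z)) =
            inj₂ (∣p∣≤length (x ∷ y ∷ a ∷ z ∷ []) λ w∈S → listed (location w∈S))
            where
            listed : ∀ {w} → w ≡ x ⊎ w ≡ y ⊎ Ahead w ⊎ Behind w → w ∈ˡ x ∷ y ∷ a ∷ z ∷ []
            listed (inj₁ w≡x)        = here w≡x
            listed (inj₂ (inj₁ w≡y)) = there (here w≡y)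
            listed (inj₂ (inj₂ (inj₁ (w∈S , w≢x , w≢y , x⇒w)))) = there (there (here (δ-injective
              (trans (proj₂ (opposite w∈S z∈S w≢x w≢y x⇒w ¬x⇒z)) (sym (proj₂ (opposite a∈S z∈S a≢x a≢y x⇒a ¬x⇒z)))))))
            listed (inj₂ (inj₂ (inj₂ (w∈S , ¬x⇒w)))) = there (there (there (here (δ-injective
              (trans (proj₁ (opposite a∈S w∈S a≢x a≢y x⇒a ¬x⇒w)) (sym (proj₁ (opposite a∈S z∈S a≢x a≢y x⇒a ¬x⇒z))))))))

      Antipodal : Fin k → Fin k → Set
      Antipodal x y = x ∈ S × y ∈ S × x ≢ y × x ⇒ y × y ⇒ x

      large⇒∣S∣≤ : ∣ S ∣ ≤ suc D ⊎ ∣ S ∣ ≤ 4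
      large⇒∣S∣≤ = decide
        (any? λ x → any? λ y → (x ∈? S) ×-dec ((y ∈? S) ×-dec
          (¬? (x ≟ᶠ y) ×-dec ((δ x y ≤? D) ×-dec (δ y x ≤? D)))))
        (any? (_∈? S))
        where
        decide : Dec (∃[ x ] ∃[ y ] Antipodal x y) → Dec (∃[ r ] r ∈ S) → ∣ S ∣ ≤ suc D ⊎ ∣ S ∣ ≤ 4
        decide (yes (x , y , x∈S , y∈S , x≢y , x⇒y , y⇒x)) _ = antipodal⇒∣S∣≤ x∈S y∈S x≢y x⇒y y⇒x
        decide (no _)     (no ∄r) = inj₁ (≤-trans (∣p∣≤length [] λ x∈S → contradiction (_ , x∈S) ∄r) z≤n)
        decide (no ∄pair) (yes (r₀ , r₀∈S)) =
          let r , _ , r⇒ = sourceOf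
                (λ {x} {y} x∈S y∈S x⇒y y⇒x → decidable-stable (x ≟ᶠ y) λ x≢y →
                  ∄pair (x , y , x∈S , y∈S , x≢y , x⇒y , y⇒x))
                r₀ r₀∈S (filter (_∈? S) (allFin k)) (λ y∈ → proj₂ (∈-filter⁻ (_∈? S) {xs = allFin k} y∈))
          in inj₁ (source⇒∣S∣≤ r λ {y} y∈S → r⇒ (∈-filter⁺ (_∈? S) (∈-allFin y) y∈S))

    -- Sets of at most `s` elements are cliques vacuously and are bounded directly. The exceptional
    -- size 4 is harmless since both `c` and `s` are at least 2.
    clique≤ : ∀ c → 2 ≤ c → suc D ≤ c * s → ∣ S ∣ ≤ c * s
    clique≤ c 2≤c m≤cs = decide (suc s ≤? ∣ S ∣)
      where
      decide : Dec (s < ∣ S ∣) → ∣ S ∣ ≤ c * s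
      decide (no s≮S)  = ≤-trans (≮⇒≥ s≮S) (m≤n*m s c {{>-nonZero (≤-trans (s≤s z≤n) 2≤c)}})
      decide (yes s<S) = [ (λ S≤m → ≤-trans S≤m m≤cs) , (λ S≤4 → ≤-trans S≤4 (*-mono-≤ 2≤c 2≤s)) ]′ (large⇒∣S∣≤ s<S)

-- Perfection of cycles as a density condition

id-occupied : ∀ {n} (3≤n : 3 ≤ n) .{{_ : NonZero n}} P → InducedCycle.Occupied 3≤n (↣-id (Fin n)) P
id-occupied {n} 3≤n P = fromℕ< (m%n<n P n) , sym (toℕ-fromℕ< (m%n<n P n))

module CyclePerfection (n : ℕ) (3≤n : 3 ≤ n) {s d D : ℕ} .{{_ : NonZero s}}
  (D≤d : D ≤ d) (D≤h : D ≤ ⌊ n /2⌋) (D-max : ∀ {ℓ} → ℓ ≤ d → ℓ ≤ ⌊ n /2⌋ → ℓ ≤ D) where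

  private
    instance
      n≢0 : NonZero n
      n≢0 = >-nonZero (≤-trans (s≤s z≤n) 3≤n)

  -- An induced subgraph either keeps every vertex and is the cycle relabelled, or misses one and
  -- has a hole.
  density⇒perfect : ∀ c t → c * s < suc D → t * suc D ≤ n * s → n ≤ suc c * t → Perfect (cycle n 3≤n) (suc s) d
  density⇒perfect c t cs<m tm≤ns n≤ct k f = decide (all? λ r → occupied? (toℕ r))
    where
    open InducedCycle 3≤n f using (Occupied; occupied?; occupied-cong)
    decide : Dec (∀ r → Occupied (toℕ {n} r)) → HasPerfectNumbers (induced (cycle n 3≤n) f) s d
    decide (yes occ) = Full.full⇒perfect 3≤n f
      (λ P → occupied-cong (trans (cong (_% n) (toℕ-fromℕ< (m%n<n P n))) (m%n%n≡m%n P n)) (occ (fromℕ< (m%n<n P n))))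
      D≤d D≤h D-max c t cs<m tm≤ns n≤ct
    decide (no ¬occ) = let r , ¬occ-r = ¬∀⟶∃¬ n _ (λ r → occupied? (toℕ r)) ¬occ
                       in Hole.hole⇒perfect 3≤n f s d (toℕ r) (toℕ<n r) ¬occ-r

  -- Perfection is applied to the whole cycle: the clique bound leaves at most `c` colours, and a
  -- colouring with that many yields `t`.
  perfect⇒density : 2 ≤ s → ∀ c → 2 ≤ c → suc D ≤ c * s → Perfect (cycle n 3≤n) (suc s) d →
    ∃[ t ] (t * suc D ≤ n * s × n ≤ c * t)
  perfect⇒density 2≤s c 2≤c m≤cs perfect
    with χ , ω , (1≤χ , colourable , _) , ((S , clique , S≡ω) , _) , χ≡⌈ω/s⌉ ← perfect n (↣-id (Fin n))
    with t , tm≤ns , n≤χt ← Full.colourable⇒density 3≤n (↣-id (Fin n)) (id-occupied 3≤n) D≤d D≤h colourable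
    = t , tm≤ns , ≤-trans n≤χt (*-monoˡ-≤ t (χ≤c ω 1≤χ χ≡⌈ω/s⌉
        (subst (_≤ c * s) S≡ω (CliqueBound.clique≤ 3≤n (↣-id (Fin n)) (id-occupied 3≤n) 2≤s D+D≤n D-max clique c 2≤c m≤cs))))
    where
    D+D≤n : D + D ≤ n
    D+D≤n = ≤-trans (+-mono-≤ D≤h D≤h) (⌊n/2⌋+⌊n/2⌋≤n n)
    χ≤c : ∀ {χ} ω → 1 ≤ χ → ℤ.+ χ ≡ ⌈ (ℤ.+ ω) / s ⌉ → ω ≤ c * s → χ ≤ c
    χ≤c {χ} zero 1≤χ e ω≤cs = contradiction
      (ℤ.+-injective (trans e (⌈/⌉-unique 0 s 0 z≤n (>-nonZero⁻¹ s)))) λ χ≡0 → <⇒≢ 1≤χ (sym χ≡0)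
    χ≤c {χ} ω@(suc _) 1≤χ e ω≤cs with c₀ , c₀s<ω , ω≤1+c₀s ← ceiling-div ω s (s≤s z≤n) = subst (_≤ c)
      (sym (ℤ.+-injective (trans e (⌈/⌉-unique ω s (suc c₀) ω≤1+c₀s
        (subst (suc c₀ * s <_) (+-comm s ω) (+-monoʳ-< s c₀s<ω))))))
      (*-cancelʳ-< s c₀ c (<-≤-trans c₀s<ω ω≤cs))

cycle-diameter : ∀ {n} (3≤n : 3 ≤ n) {D} → IsDiameter (cycle n 3≤n) D → D ≡ ⌊ n /2⌋
cycle-diameter {n} 3≤n = Full.diameter≡half 3≤n (↣-id (Fin n)) (id-occupied 3≤n)
  where
  instance
    n≢0 : NonZero n
    n≢0 = >-nonZero (≤-trans (s≤s z≤n) 3≤n)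

-- Arithmetical forms of the density condition

n≤1+⌊n/2⌋+⌊n/2⌋ : ∀ n → n ≤ suc (⌊ n /2⌋ + ⌊ n /2⌋)
n≤1+⌊n/2⌋+⌊n/2⌋ 0 = z≤n
n≤1+⌊n/2⌋+⌊n/2⌋ 1 = s≤s z≤n
n≤1+⌊n/2⌋+⌊n/2⌋ (suc (suc n)) =
  s≤s (≤-trans (s≤s (n≤1+⌊n/2⌋+⌊n/2⌋ n)) (≤-reflexive (cong suc (sym (+-suc ⌊ n /2⌋ ⌊ n /2⌋)))))

-- Here `suc s` stands for k - 1, so `suc (s + s)` is 2k - 3. Since `n` is at most `suc (h + h)`,
-- the first inequality bounds `t` by this number.
density⇒half : ∀ {h s n c t} → n ≤ suc (h + h) → t * suc h ≤ n * suc s → n ≤ c * t → n ≤ suc (s + s) * c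
density⇒half {h} {s} {n} {c} {t} n≤ tm≤ns n≤ct = ≤-trans n≤ct (≤-trans (*-monoʳ-≤ c
  (≤-pred (*-cancelʳ-< (suc h) t (suc (suc (s + s))) (begin-strict
    t * suc h                         ≤⟨ tm≤ns ⟩
    n * suc s                         <⟨ *-monoˡ-< (suc s) (s≤s n≤) ⟩
    suc (suc (h + h)) * suc s         ≡⟨ identity h s ⟩
    suc (suc (s + s)) * suc h         ∎)))) (≤-reflexive (*-comm c (suc (s + s)))))
  where
  open ≤-Reasoning
  identity : ∀ h s → suc (suc (h + h)) * suc s ≡ suc (suc (s + s)) * suc h
  identity = solve-∀

-- The natural witness is `suc (s + s)`. It is too large only when `n` is even and `h ≤ s + s`; then
-- `s + s` will do, because two colours already suffice for the second inequality.
half⇒density : ∀ {h s n c} → n ≡ h + h ⊎ n ≡ suc (h + h) → s < h → 2 ≤ c → n ≤ suc (s + s) * c →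
  ∃[ t ] (t * suc h ≤ n * suc s × n ≤ c * t)
half⇒density {h} {s} {n} {c} (inj₂ refl) s<h 2≤c n≤ = suc (s + s) , le , ≤-trans n≤ (≤-reflexive (*-comm (suc (s + s)) c))
  where
  identity : ∀ s j → suc ((s + j) + (s + j)) * suc s ≡ suc (s + s) * suc (s + j) + j
  identity = solve-∀
  le : suc (s + s) * suc h ≤ suc (h + h) * suc s
  le = subst (λ h → suc (s + s) * suc h ≤ suc (h + h) * suc s) (m+[n∸m]≡n (<⇒≤ s<h))
    (≤-trans (m≤m+n _ (h ∸ s)) (≤-reflexive (sym (identity s (h ∸ s)))))
half⇒density {h} {s} {n} {c} (inj₁ refl) s<h 2≤c n≤ with suc (s + s) ≤? h
... | yes 2s<h = suc (s + s) , le , ≤-trans n≤ (≤-reflexive (*-comm (suc (s + s)) c))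
  where
  identity : ∀ s j → ((suc (s + s) + j) + (suc (s + s) + j)) * suc s ≡ suc (s + s) * suc (suc (s + s) + j) + j
  identity = solve-∀
  le : suc (s + s) * suc h ≤ (h + h) * suc s
  le = subst (λ h → suc (s + s) * suc h ≤ (h + h) * suc s) (m+[n∸m]≡n 2s<h)
    (≤-trans (m≤m+n _ (h ∸ suc (s + s))) (≤-reflexive (sym (identity s (h ∸ suc (s + s))))))
... | no 2s≮h = s + s , le , ≤-trans (+-mono-≤ h≤2s h≤2s) (≤-trans (≤-reflexive (cong (s + s +_) (sym (+-identityʳ (s + s))))) (*-monoˡ-≤ (s + s) 2≤c))
  where
  h≤2s : h ≤ s + s
  h≤2s = ≤-pred (≰⇒> 2s≮h)
  identity : ∀ s j → ((s + j) + (s + j)) * suc s ≡ (s + s) * suc (s + j) + (j + j)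
  identity = solve-∀
  le : (s + s) * suc h ≤ (h + h) * suc s
  le = subst (λ h → (s + s) * suc h ≤ (h + h) * suc s) (m+[n∸m]≡n (<⇒≤ s<h))
    (≤-trans (m≤m+n _ _) (≤-reflexive (sym (identity s (h ∸ s)))))

halves : ∀ n → n ≡ ⌊ n /2⌋ + ⌊ n /2⌋ ⊎ n ≡ suc (⌊ n /2⌋ + ⌊ n /2⌋)
halves n with m≤n⇒m<n∨m≡n (n≤1+⌊n/2⌋+⌊n/2⌋ n)
... | inj₁ (s≤s n≤) = inj₁ (≤-antisym n≤ (⌊n/2⌋+⌊n/2⌋≤n n))
... | inj₂ e        = inj₂ e

-- Cancelling `s` turns the first inequality into `t * c ≤ n`, so the two inequalities force
-- equality.
integral⇔density : ∀ {d c s n} .{{_ : NonZero s}} → suc d ≡ c * s →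
  (∃[ t ] (t * suc d ≤ n * s × n ≤ c * t)) ⇔ (c ∣ⁿ n)
integral⇔density {d} {c} {s} {n} m≡cs = mk⇔
  (λ (t , tm≤ns , n≤ct) → divides t (≤-antisym (≤-trans n≤ct (≤-reflexive (*-comm c t)))
    (*-cancelʳ-≤ (t * c) n s (≤-trans (≤-reflexive (tcs t)) tm≤ns))))
  (λ { (divides t n≡tc) → t , ≤-reflexive (trans (sym (tcs t)) (cong (_* s) (sym n≡tc))) ,
         ≤-reflexive (trans n≡tc (*-comm t c)) })
  where
  tcs : ∀ t → t * c * s ≡ t * suc d
  tcs t = trans (*-assoc t c s) (cong (t *_) (sym m≡cs))

GapWitness : ∀ n (q : ℚ) → .{{ℚ.NonZero (⌈ q ⌉ / 1 ℚ.- q)}} → ℤ → Set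
GapWitness n q j =
    ((ℤ.+ 1) ℤ.≤ j)
  × (j / 1 ℚ.< (q ℚ.- 1ℚ) ℚ.÷ (⌈ q ⌉ / 1 ℚ.- q))
  × (j ℤ.* ⌈ q ⌉ ℤ.< ℤ.+ n)
  × ((ℤ.+ n) / 1 ℚ.< ((j ℤ.+ ℤ.+ 1) / 1) ℚ.* q)

-- In the application `a` is d + 1 and `suc s` is k - 1; the bounds make `suc c` the ceiling of q.
module NonIntegral {a c s n : ℕ} .{{_ : NonZero a}} (q∉ℤ : NonInteger ((ℤ.+ a) / suc s))
  (cs<a : c * suc s < a) (a≤1+cs : a ≤ suc c * suc s) (a≤n : a ≤ n) where

  private
    q : ℚ
    q = (ℤ.+ a) / suc s

    instance
      gap≢0 : ℚ.NonZero (⌈ q ⌉ / 1 ℚ.- q)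
      gap≢0 = ⌈q⌉-q-nonZero q∉ℤ

    ⌈q⌉≡1+c : ⌈ q ⌉ ≡ ℤ.+ suc c
    ⌈q⌉≡1+c = ⌈/⌉-unique a (suc s) (suc c) a≤1+cs
      (subst (suc c * suc s <_) (+-comm (suc s) a) (+-monoʳ-< (suc s) cs<a))

    q<⌈q⌉ : q ℚ.< ⌈ q ⌉ / 1
    q<⌈q⌉ = subst (λ z → q ℚ.< z / 1) (sym ⌈q⌉≡1+c) (//<1⁺ {ℤ.+ a} {ℤ.+ suc c} {s} (subst ((ℤ.+ a) ℤ.<_) (ℤ.pos-* (suc c) (suc s))
      (ℤ.+<+ (≤∧≢⇒< a≤1+cs λ a≡ → q∉ℤ (ℤ.+ suc c) (≡*⇒/≡/1 {ℤ.+ a} {s} {ℤ.+ suc c} (trans (cong ℤ.+_ a≡) (ℤ.pos-* (suc c) (suc s))))))))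

    /1<*q : ∀ {x y} → x * suc s < y * a → (ℤ.+ x) / 1 ℚ.< ((ℤ.+ y) / 1) ℚ.* q
    /1<*q {x} {y} lt = /1<*/⁺ {ℤ.+ x} {ℤ.+ y} {ℤ.+ a} {s} (subst₂ ℤ._<_ (ℤ.pos-* x (suc s)) (ℤ.pos-* y a) (ℤ.+<+ lt))

  -- From t q ≤ n < (j + 1) q follows `t ≤ j`, so `n` is at most j times the ceiling of q, against
  -- the third condition on `j`.
  density⇒∄gap : (∃[ t ] (t * a ≤ n * suc s × n ≤ suc c * t)) → ¬ (∃[ j ] GapWitness n q j)
  density⇒∄gap (t , ta≤ns , n≤ct) (ℤ.+ j , _ , _ , jc<n , n<[j+1]q) = <⇒≱ j*c<n
    (≤-trans n≤ct (≤-trans (*-monoʳ-≤ (suc c) t≤j) (≤-reflexive (*-comm (suc c) j))))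
    where
    j*c<n : j * suc c < n
    j*c<n = ℤ.drop‿+<+ (subst (ℤ._< ℤ.+ n) (trans (cong ((ℤ.+ j) ℤ.*_) ⌈q⌉≡1+c) (sym (ℤ.pos-* j (suc c)))) jc<n)
    ns<[j+1]a : n * suc s < (j + 1) * a
    ns<[j+1]a = ℤ.drop‿+<+ (subst₂ ℤ._<_ (sym (ℤ.pos-* n (suc s))) (sym (ℤ.pos-* (j + 1) a))
      (/1<*/⁻ {ℤ.+ n} {ℤ.+ (j + 1)} {ℤ.+ a} {s} n<[j+1]q))
    t≤j : t ≤ j
    t≤j = ≤-pred (subst (t <_) (+-comm j 1) (*-cancelʳ-< a t (j + 1) (≤-<-trans ta≤ns ns<[j+1]a)))
  density⇒∄gap _ (ℤ.-[1+ _ ] , () , _)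

  -- Take `t` to be the floor of n / q. If it failed the second inequality, it would itself be a
  -- gap: t times the ceiling, plus 1, is at most `n` and so below (t + 1) q, from which `<÷⁺` gives
  -- the upper bound on `t`.
  ∄gap⇒density : ¬ (∃[ j ] GapWitness n q j) → ∃[ t ] (t * a ≤ n * suc s × n ≤ suc c * t)
  ∄gap⇒density ∄j = t , m/n*n≤m (n * suc s) a , ≮⇒≥ λ ct<n →
    let tc<n : t * suc c < n
        tc<n = subst (_< n) (*-comm (suc c) t) ct<n
    in ∄j (ℤ.+ t , ℤ.+≤+ 1≤t ,
      <÷⁺ ((ℤ.+ t) / 1) (⌈ q ⌉ / 1) q q<⌈q⌉
        (subst₂ ℚ._<_
          (sym (trans (cong (λ z → ((ℤ.+ t) / 1) ℚ.* (z / 1) ℚ.+ 1ℚ) ⌈q⌉≡1+c)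
            (trans (cong (ℚ._+ 1ℚ) (trans (/1-* (ℤ.+ t) (ℤ.+ suc c)) (cong (_/ 1) (sym (ℤ.pos-* t (suc c))))))
              (/1-+ (ℤ.+ (t * suc c)) (ℤ.+ 1)))))
          (cong (ℚ._* q) (sym (/1-+ (ℤ.+ t) (ℤ.+ 1))))
          (/1<*q {t * suc c + 1} {t + 1} (≤-<-trans (*-monoˡ-≤ (suc s) (subst (_≤ n) (+-comm 1 (t * suc c)) tc<n)) ns<[t+1]a))) ,
      subst (ℤ._< ℤ.+ n) (trans (ℤ.pos-* t (suc c)) (cong ((ℤ.+ t) ℤ.*_) (sym ⌈q⌉≡1+c))) (ℤ.+<+ tc<n) ,
      /1<*q {n} {t + 1} ns<[t+1]a)
    where
    t = n * suc s /ℕ a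
    1≤t : 1 ≤ t
    1≤t = m≥n⇒m/n>0 (≤-trans a≤n (m≤m*n n (suc s)))
    ns<[t+1]a : n * suc s < (t + 1) * a
    ns<[t+1]a = subst₂ _<_ (sym (m≡m%n+[m/n]*n (n * suc s) a)) (cong (_* a) (+-comm 1 t))
      (+-monoˡ-< (t * a) (m%n<n (n * suc s) a))

  nonIntegral⇔density : (∃[ t ] (t * a ≤ n * suc s × n ≤ suc c * t)) ⇔ (¬ (∃[ j ] GapWitness n q j))
  nonIntegral⇔density = mk⇔ density⇒∄gap ∄gap⇒density

s<m⇒2≤1+c : ∀ {c s m} → s < m → m ≤ suc c * s → 2 ≤ suc c
s<m⇒2≤1+c {c} {s} s<m m≤ = *-cancelʳ-< s 1 (suc c) (≤-<-trans (≤-reflexive (*-identityˡ s)) (<-≤-trans s<m m≤))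

-- From the density condition to the cases by diameter

open import Data.Integer.Base using (+_)
open import Data.Integer.Divisibility using (_∣_)

positive-factor : ∀ {a s} z → + suc a ≡ z ℤ.* (+ suc s) → ∃[ c ] (z ≡ + suc c × suc a ≡ suc c * suc s)
positive-factor (+ zero)      ()
positive-factor {s = s} (+ suc c) e = c , refl , ℤ.+-injective (trans e (sym (ℤ.pos-* (suc c) (suc s))))
positive-factor ℤ.-[1+ c ]    ()

-- The equation `a ≡ suc d` bridges the `d + 1` of the theorem and the `suc d` of the density
-- condition.
integer-case : ∀ {a d s n} {P : Set} → a ≡ suc d → suc s < a →
  (∀ c → c * suc s < suc d → 2 ≤ suc c → suc d ≤ suc c * suc s →
    P ⇔ (∃[ t ] (t * suc d ≤ n * suc s × n ≤ suc c * t))) →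
  ∀ z → (+ a) / suc s ≡ z / 1 → P ⇔ (z ∣ + n)
integer-case {s = s} {n} {P} refl s<a P⇔ z q≡z =
  let c , z≡c , a≡cs = positive-factor z (/≡/1⇒≡* {z = z} q≡z)
  in subst (λ z → P ⇔ (z ∣ + n)) (sym z≡c) (⇔-trans
       (P⇔ c (subst (c * suc s <_) (sym a≡cs) (m<n+m (c * suc s) (s≤s z≤n)))
         (s<m⇒2≤1+c s<a (≤-reflexive a≡cs)) (≤-reflexive a≡cs))
       (integral⇔density {c = suc c} {s = suc s} a≡cs))

noninteger-case : ∀ {a d s n} {P : Set} → a ≡ suc d → suc s < a → a ≤ n →
  (∀ c → c * suc s < suc d → 2 ≤ suc c → suc d ≤ suc c * suc s →
    P ⇔ (∃[ t ] (t * suc d ≤ n * suc s × n ≤ suc c * t))) →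
  ∀ (q∉ℤ : NonInteger ((+ a) / suc s)) → P ⇔ (¬ (∃[ j ] GapWitness n ((+ a) / suc s) {{⌈q⌉-q-nonZero q∉ℤ}} j))
noninteger-case {a} {s = s} {n} refl s<a a≤n P⇔ q∉ℤ =
  let c , c< , ≤c = ceiling-div a (suc s) (s≤s z≤n)
  in ⇔-trans (P⇔ c c< (s<m⇒2≤1+c s<a ≤c) ≤c) (NonIntegral.nonIntegral⇔density {a} {c} {s} {n} q∉ℤ c< ≤c a≤n)

theorem5p13 :
    ∀ (k d n : ℕ) (3≤k : 3 ≤ k) → k ≤ d + 1 → (3≤n : 3 ≤ n) →
    let
      instance
        k-1≢0 : NonZero (k ∸ 1)
        k-1≢0 = k∸1-nonZero 3≤k
      Cₙ : Graph n
      Cₙ = cycle n 3≤n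
      q : ℚ
      q = (+ (d + 1)) / (k ∸ 1)
    in
    ∀ (diam : ℕ) → IsDiameter Cₙ diam →
      ( diam < d →
          (diam ≤ k ∸ 2 → Perfect Cₙ k d)
        × (diam > k ∸ 2 →
            Perfect Cₙ k d
              ⇔ (+ n) ℤ.≤ (+ (2 * k ∸ 3)) ℤ.* ⌈ (+ (⌊ n /2⌋ + 1)) / (k ∸ 1) ⌉) )
    × ( d ≤ diam →
          (∀ (z : ℤ) → q ≡ z / 1 → Perfect Cₙ k d ⇔ (z ∣ + n))
        × (∀ (q∉ℤ : NonInteger q) →
            let
              instance
                ⌈q⌉-q≢0 : ℚ.NonZero (⌈ q ⌉ / 1 ℚ.- q)
                ⌈q⌉-q≢0 = ⌈q⌉-q-nonZero q∉ℤ
            in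
            Perfect Cₙ k d
              ⇔ (¬ (∃[ j ]
                    ( (+ 1) ℤ.≤ j
                    × j / 1 ℚ.< (q ℚ.- 1ℚ) ℚ.÷ (⌈ q ⌉ / 1 ℚ.- q)
                    × j ℤ.* ⌈ q ⌉ ℤ.< + n
                    × (+ n) / 1 ℚ.< ((j ℤ.+ + 1) / 1) ℚ.* q )))) )
theorem5p13 (suc (suc (suc k₀))) d n (s≤s (s≤s (s≤s z≤n))) k≤d+1 3≤n diam isDiam =
  small (cycle-diameter 3≤n isDiam) , large (cycle-diameter 3≤n isDiam)
  where
  h s : ℕ
  h = ⌊ n /2⌋
  s = suc (suc k₀)

  small : ∀ {diam} → diam ≡ h → diam < d →
      (diam ≤ suc k₀ → Perfect (cycle n 3≤n) (suc s) d)
    × (diam > suc k₀ → Perfect (cycle n 3≤n) (suc s) d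
        ⇔ (+ n) ℤ.≤ (+ (2 * suc s ∸ 3)) ℤ.* ⌈ (+ (h + 1)) / s ⌉)
  small refl h<d =
      -- A shortest path has at most `s` vertices, so a single colour works, with `t = n`.
      (λ h≤s-1 → density⇒perfect 0 n (s≤s z≤n) (*-monoʳ-≤ n (s≤s h≤s-1)) (≤-reflexive (sym (+-identityʳ n))))
    , λ s-1<h → let c , c< , ≤c = ceiling-div (suc h) s (s≤s z≤n)
                    2≤c = s<m⇒2≤1+c (s≤s s-1<h) ≤c
                in ⇔-trans (mk⇔
      (λ perfect → let t , tm≤ns , n≤ct = perfect⇒density (s≤s (s≤s z≤n)) (suc c) 2≤c ≤c perfect
                   in density⇒half {h} {suc k₀} {n} {suc c} (n≤1+⌊n/2⌋+⌊n/2⌋ n) tm≤ns n≤ct)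
      (λ n≤ → let t , tm≤ns , n≤ct = half⇒density (halves n) s-1<h 2≤c n≤
              in density⇒perfect c t c< tm≤ns n≤ct))
      (subst (λ z → (n ≤ suc (suc k₀ + suc k₀) * suc c) ⇔ ((+ n) ℤ.≤ z)) (sym (rhs c c< ≤c))
        (mk⇔ ℤ.+≤+ ℤ.drop‿+≤+))
    where
    -- The diameter is the smaller number here, so `D` is `h`.
    open CyclePerfection n 3≤n {s} {d} {h} (<⇒≤ h<d) ≤-refl (λ _ ℓ≤h → ℓ≤h)
    2k-3 : ∀ k₀ → 2 * suc (suc (suc k₀)) ≡ 3 + suc (suc k₀ + suc k₀)
    2k-3 = solve-∀
    rhs : ∀ c → c * s < suc h → suc h ≤ suc c * s →
      (+ (2 * suc s ∸ 3)) ℤ.* ⌈ (+ (h + 1)) / s ⌉ ≡ + (suc (suc k₀ + suc k₀) * suc c)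
    rhs c c< ≤c = trans (cong₂ (λ x y → (+ x) ℤ.* y) (cong (_∸ 3) (2k-3 k₀))
        (⌈/⌉-unique (h + 1) s (suc c) (subst (_≤ suc c * s) (+-comm 1 h) ≤c)
          (subst (suc c * s <_) (trans (+-comm s (suc h)) (cong (_+ s) (+-comm 1 h))) (+-monoʳ-< s c<))))
      (sym (ℤ.pos-* (suc (suc k₀ + suc k₀)) (suc c)))

  large : ∀ {diam} → diam ≡ h → d ≤ diam →
      (∀ (z : ℤ) → (+ (d + 1)) / s ≡ z / 1 → Perfect (cycle n 3≤n) (suc s) d ⇔ (z ∣ + n))
    × (∀ (q∉ℤ : NonInteger ((+ (d + 1)) / s)) → Perfect (cycle n 3≤n) (suc s) d
        ⇔ (¬ (∃[ j ] GapWitness n ((+ (d + 1)) / s) {{⌈q⌉-q-nonZero q∉ℤ}} j)))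
  large refl d≤h = integer-case (+-comm d 1) k≤d+1 perfect⇔density
            , noninteger-case (+-comm d 1) k≤d+1 d+1≤n perfect⇔density
    where
    -- Now `d` does not exceed the diameter, so `D` is `d`.
    open CyclePerfection n 3≤n {s} {d} {d} ≤-refl d≤h (λ ℓ≤d _ → ℓ≤d)
    perfect⇔density : ∀ c → c * s < suc d → 2 ≤ suc c → suc d ≤ suc c * s →
      Perfect (cycle n 3≤n) (suc s) d ⇔ (∃[ t ] (t * suc d ≤ n * s × n ≤ suc c * t))
    perfect⇔density c c< 2≤c ≤c = mk⇔ (perfect⇒density (s≤s (s≤s z≤n)) (suc c) 2≤c ≤c)
      λ (t , tm≤ns , n≤ct) → density⇒perfect c t c< tm≤ns n≤ct
    d+1≤n : d + 1 ≤ n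
    -- Both `d` and 1 are at most `h`, as `1 ≤ d ≤ h`.
    d+1≤n = ≤-trans (+-mono-≤ d≤h (≤-trans (≤-trans (≤-trans (s≤s z≤n) (≤-pred (subst (3 + k₀ ≤_) (+-comm d 1) k≤d+1))) d≤h) ≤-refl)) (⌊n/2⌋+⌊n/2⌋≤n n)
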